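{- Let $k\ge 2$ be a fixed integer. Let $\mathcal G$ be a $k$-uniform $D$-regular hypergraph on $n$ vertices, and let $q = (1+o(1))D$ (as $D\to\infty$). If the maximum codegree of $\mathcal G$ satisfies $\Delta_2(\mathcal G) = o(q)$, then the number of proper $q$-edge-colorings of $\mathcal G$ is at most \[ \left((1+o(1))\frac{q}{e^k}\right)^{Dn/k}. \]
   Context: A hypergraph is $k$-uniform if every edge has exactly $k$ vertices, and $D$-regular if every vertex lies in exactly $D$ edges. The codegree of two vertices is the number of edges containing both; $\Delta_2(\mathcal G)$ is the maximum codegree over pairs of distinct vertices. A proper $q$-edge-coloring is an assignment of colors from $\{1,\dots,q\}$ to the edges such that no two edges sharing a vertex receive the same color. -}

module Defs where

open import Data.Nat using (ℕ; zero; suc)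
open import Data.Bool using (Bool; true; false)
open import Data.Fin using (Fin)
open import Data.Fin.Properties using (_≟_; all?; any?)
open import Data.Fin.Subset using (Subset; _∈_)
open import Data.Fin.Subset.Properties using (_∈?_)
open import Data.Vec using (Vec; []; _∷_; lookup)
open import Data.List using (List; []; _∷_; length; filter; map; concatMap)
open import Data.Product using (∃; _×_)
open import Relation.Nullary using (¬_; Dec; yes; no; does)
open import Relation.Nullary.Decidable using (_×-dec_; _→-dec_; ¬?)
open import Relation.Binary.PropositionalEquality using (_≡_; _≢_)

Hypergraph : ℕ → ℕ → Set
Hypergraph n E = Fin E → Subset n

Simple : ∀ {n E} → Hypergraph n E → Set
Simple {E = E} G = (i j : Fin E) → G i ≡ G j → i ≡ j

countTrue : ∀ {m} → (Fin m → Bool) → ℕ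
countTrue {zero}  f = 0
countTrue {suc m} f with f Fin.zero
... | true  = suc (countTrue (λ i → f (Fin.suc i)))
... | false = countTrue (λ i → f (Fin.suc i))

Uniform : ∀ {n E} → ℕ → Hypergraph n E → Set
Uniform {E = E} k G = (i : Fin E) → Data.Fin.Subset.∣ G i ∣ ≡ k

degree : ∀ {n E} → Hypergraph n E → Fin n → ℕ
degree G v = countTrue (λ i → does (v ∈? G i))

Regular : ∀ {n E} → ℕ → Hypergraph n E → Set
Regular {n} D G = (v : Fin n) → degree G v ≡ D

codegree : ∀ {n E} → Hypergraph n E → Fin n → Fin n → ℕ
codegree G u v = countTrue (λ i → does ((u ∈? G i) ×-dec (v ∈? G i)))

Share : ∀ {n E} → Hypergraph n E → Fin E → Fin E → Set
Share G i j = ∃ λ v → v ∈ G i × v ∈ G j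

share? : ∀ {n E} (G : Hypergraph n E) (i j : Fin E) → Dec (Share G i j)
share? G i j = any? (λ v → (v ∈? G i) ×-dec (v ∈? G j))

Proper : ∀ {n E q} → Hypergraph n E → Vec (Fin q) E → Set
Proper {E = E} G c =
  (i j : Fin E) → i ≢ j → Share G i j → lookup c i ≢ lookup c j

proper? : ∀ {n E q} (G : Hypergraph n E) (c : Vec (Fin q) E) → Dec (Proper G c)
proper? G c = all? λ i → all? λ j →
  ¬? (i ≟ j) →-dec (share? G i j →-dec ¬? (lookup c i ≟ lookup c j))

allFinL : (q : ℕ) → List (Fin q)
allFinL zero    = []
allFinL (suc q) = Fin.zero ∷ map Fin.suc (allFinL q)

allVecs : (q E : ℕ) → List (Vec (Fin q) E)
allVecs q zero    = [] ∷ []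
allVecs q (suc E) = concatMap (λ x → map (x ∷_) (allVecs q E)) (allFinL q)

numProperColorings : ∀ {n E} → Hypergraph n E → (q : ℕ) → ℕ
numProperColorings {E = E} G q = length (filter (proper? G) (allVecs q E))

{-# OPTIONS --safe #-}
module Submission where

-- Entropy proof. Give every edge a uniformly random level in {0, …, L − 1} and reveal a uniform
-- random proper colouring X edge by edge in order of increasing level. By the chain rule, log of the
-- number M of colourings is at most the sum over e of the mean of log N(e), where N(e) is the number of
-- colours not used by X on a neighbour of e of smaller level. Regularity, q ≈ D and small codegrees
-- force all but o(q) colours to occur on exactly k neighbours of e; such a colour is still free with
-- probability ((L − j)/L)^k when e has level j. Hence, by AM-GM, N(e) has geometric mean at most
-- (1 + o(1)) q ((L − j)/L)^k given j, and averaging over j yields (1 + o(1)) q (L!/L^L)^(k/L), which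
-- approaches q/e^k as L grows. All inequalities between logarithms are kept as inequalities between
-- products of natural numbers.

open import Defs
open import Algebra.Structures using (IsCommutativeMonoid)
open import Data.Bool using (Bool; true; false; if_then_else_)
open import Data.Fin as Fin using (Fin; toℕ)
open import Data.Fin.Properties using (_≟_; all?; any?; toℕ<n)
open import Data.Fin.Subset using (Subset; ∣_∣)
open import Data.Fin.Subset.Properties using () renaming (_∈?_ to _∈ˢ?_)
open import Data.List using (List; []; _∷_; _++_; length; replicate; map; filter; concatMap)
open import Data.List.Membership.DecPropositional using (_∈?_)
open import Data.List.Membership.Propositional using (_∈_; _∉_)
open import Data.List.Membership.Propositional.Properties using (∈-map⁺; ∈-map⁻; ∈-filter⁻)
open import Data.List.Properties using (length-++; length-replicate; length-map)
open import Data.List.Relation.Binary.Permutation.Propositional using (_↭_; prep; swap; ↭-sym)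
import Data.List.Relation.Binary.Permutation.Propositional as Perm
open import Data.List.Relation.Binary.Permutation.Propositional.Properties using (∈-resp-↭)
open import Data.List.Relation.Unary.All as All using (All; []; _∷_)
import Data.List.Relation.Unary.All.Properties as All
open import Data.List.Relation.Unary.AllPairs as AllPairs using (AllPairs; []; _∷_)
import Data.List.Relation.Unary.AllPairs.Properties as AllPairs
open import Data.List.Relation.Unary.Any using (here; there)
open import Data.List.Relation.Unary.Linked.Properties using (Linked⇒AllPairs)
open import Data.List.Relation.Unary.Unique.Propositional using (Unique)
import Data.List.Relation.Unary.Unique.Propositional.Properties as Unique
import Data.List.Sort
open import Data.Nat using (ℕ; zero; suc; _+_; _*_; _∸_; _^_; _!; _≤_; _<_; _≥_; z≤n; s≤s; NonZero; >-nonZero; >-nonZero⁻¹; _≤?_; _<?_)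
open import Data.Nat.Divisibility using (_∣_; divides; ∣-trans; m∣m*n)
open import Data.Nat.ListAction using (sum; product)
open import Data.Nat.ListAction.Properties using (sum-++; product-++)
open import Data.Nat.Properties hiding (_≟_; _≤?_; _<?_)
open import Data.Nat.Tactic.RingSolver using (solve-∀)
open import Data.Product using (_,_; ∃; _×_; proj₁; proj₂; Σ)
open import Data.Sum using (inj₁; inj₂)
open import Data.Vec using (Vec; []; _∷_; lookup)
open import Data.Vec.Properties using (tabulate∘lookup; tabulate-cong; ∷-injectiveˡ; ∷-injectiveʳ)
open import Level using (0ℓ)
open import Relation.Binary.Bundles using (DecTotalOrder)
import Relation.Binary.Construct.On as On
open import Relation.Binary.PropositionalEquality using (_≡_; refl; sym; trans; cong; cong₂; subst; subst₂; module ≡-Reasoning; _≢_)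
open import Relation.Nullary using (Dec; yes; no; does; contradiction; ¬_)
open import Relation.Nullary.Decidable using (_→-dec_; _×-dec_; ¬?)
open import Relation.Unary using (Pred; Decidable)

-- Arithmetic inequalities

-- The arithmetic mean of ((L - j)/L)^k over j is about 1/(k + 1), while the geometric mean
-- approaches e^(-k). AM-GM may therefore average over the levels of the other edges, but not across
-- the level j of e. Weights `w j` with `w j * complement j ^ k` constant reconcile this with a
-- single AM-GM over all level vectors: they equalise the means for different j, and their product
-- cancels afterwards. Finitely many levels, in place of uniform times in [0, 1], turn averages into
-- finite sums over `allVecs L E` while keeping the levels independent. Ties exclude nothing; the
-- price is the excess of (L!)^(1/L)/L over 1/e. A colour that does not occur k times around e is
-- bounded trivially, without the decay in j, so it costs up to L^k times as much as the others.
-- Hence the tolerance s must be chosen after L. The final loss (t + 1)/t is the product of (2t +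
-- 2)/(2t + 1), spent on these colours, and (2t + 1)/(2t), spent on L being finite.

^-distribʳ-* : ∀ a b n → (a * b) ^ n ≡ a ^ n * b ^ n
^-distribʳ-* a b zero    = refl
^-distribʳ-* a b (suc n) rewrite ^-distribʳ-* a b n = [m*n]*[o*p]≡[m*o]*[n*p] a b (a ^ n) (b ^ n)

^-swap : ∀ x a b → (x ^ a) ^ b ≡ (x ^ b) ^ a
^-swap x a b = trans (^-*-assoc x a b) (trans (cong (x ^_) (*-comm a b)) (sym (^-*-assoc x b a)))

^-cancelˡ-≤ : ∀ {a b} n → .{{_ : NonZero n}} → a ^ n ≤ b ^ n → a ≤ b
^-cancelˡ-≤ n aⁿ≤bⁿ = ≮⇒≥ λ b<a → <⇒≱ (^-monoˡ-< n b<a) aⁿ≤bⁿ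

-- With b = a + x and d = c + y the two sides differ by x y.
rearrangement : ∀ {a b c d} → a ≤ b → c ≤ d → a * d + b * c ≤ a * c + b * d
rearrangement {a} {b} {c} {d} a≤b c≤d with m≤n⇒∃[o]m+o≡n a≤b | m≤n⇒∃[o]m+o≡n c≤d
... | x , refl | y , refl = subst (a * (c + y) + (a + x) * c ≤_) (identity a c x y) (m≤m+n _ (x * y))
  where
  identity : ∀ a c x y → (a * (c + y) + (a + x) * c) + x * y ≡ a * c + (a + x) * (c + y)
  identity = solve-∀

-- AM-GM for one copy of a^(n+1) and n copies of b^(n+1), free of roots. The inductive step
-- multiplies by b and then replaces a b^(n+1) + b a^(n+1) by the larger a^(n+2) + b^(n+2).
bernoulli : ∀ a b n → suc n * (a * b ^ n) ≤ a ^ suc n + n * b ^ suc n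
bernoulli a b zero    = ≤-reflexive (eq a)
  where
  eq : ∀ a → 1 * (a * 1) ≡ a * 1 + 0
  eq = solve-∀
bernoulli a b (suc n) = begin
  suc (suc n) * (a * b ^ suc n)                            ≡⟨ split n a b (b ^ n) ⟩
  a * b ^ suc n + b * (suc n * (a * b ^ n))                ≤⟨ +-monoʳ-≤ _ (*-monoʳ-≤ b (bernoulli a b n)) ⟩
  a * b ^ suc n + b * (a ^ suc n + n * b ^ suc n)          ≡⟨ regroup n a b (a ^ suc n) (b ^ suc n) ⟩
  (a * b ^ suc n + b * a ^ suc n) + n * (b * b ^ suc n)    ≤⟨ +-monoˡ-≤ _ chebyshev ⟩
  (a * a ^ suc n + b * b ^ suc n) + n * (b * b ^ suc n)    ≡⟨ merge n (a * a ^ suc n) (b * b ^ suc n) ⟩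
  a ^ suc (suc n) + suc n * b ^ suc (suc n)                ∎
  where
  open ≤-Reasoning
  split : ∀ n a b p → suc (suc n) * (a * (b * p)) ≡ a * (b * p) + b * (suc n * (a * p))
  split = solve-∀
  regroup : ∀ n a b p r → a * r + b * (p + n * r) ≡ (a * r + b * p) + n * (b * r)
  regroup = solve-∀
  merge : ∀ n p r → (p + r) + n * r ≡ p + suc n * r
  merge = solve-∀
  chebyshev : a * b ^ suc n + b * a ^ suc n ≤ a * a ^ suc n + b * b ^ suc n
  chebyshev with ≤-total a b
  ... | inj₁ a≤b = rearrangement a≤b (^-monoˡ-≤ (suc n) a≤b)
  ... | inj₂ b≤a = subst₂ _≤_ (+-comm (b * a ^ suc n) _) (+-comm (b * b ^ suc n) _)
                     (rearrangement b≤a (^-monoˡ-≤ (suc n) b≤a))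

-- `bernoulli` with a = n (S + x) and b = (n + 1) S.
am-gm-step : ∀ n .{{_ : NonZero n}} S x → suc n ^ suc n * (S ^ n * x) ≤ n ^ n * (S + x) ^ suc n
am-gm-step n S x = *-cancelˡ-≤ n (+-cancelʳ-≤ (n * b ^ suc n) _ _ (begin
  n * (suc n ^ suc n * (S ^ n * x)) + n * b ^ suc n
    ≡⟨ cong (λ p → n * (suc n ^ suc n * (S ^ n * x)) + n * (b * p)) (^-distribʳ-* (suc n) S n) ⟩
  n * (suc n ^ suc n * (S ^ n * x)) + n * (b * (suc n ^ n * S ^ n))
    ≡⟨ identity n S x (suc n ^ n) (S ^ n) ⟩
  suc n * (a * (suc n ^ n * S ^ n))       ≡⟨ cong (λ p → suc n * (a * p)) (^-distribʳ-* (suc n) S n) ⟨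
  suc n * (a * b ^ n)                     ≤⟨ bernoulli a b n ⟩
  a ^ suc n + n * b ^ suc n               ≡⟨ cong (_+ n * b ^ suc n) (^-distribʳ-* n (S + x) (suc n)) ⟩
  n ^ suc n * (S + x) ^ suc n + n * b ^ suc n   ≡⟨ cong (_+ n * b ^ suc n) (*-assoc n (n ^ n) _) ⟩
  n * (n ^ n * (S + x) ^ suc n) + n * b ^ suc n ∎))
  where
  open ≤-Reasoning
  a = n * (S + x)
  b = suc n * S
  identity : ∀ n S x p r → n * ((suc n * p) * (r * x)) + n * ((suc n * S) * (p * r)) ≡ suc n * ((n * (S + x)) * (p * r))
  identity = solve-∀

-- Induction by `am-gm-step`, which requires a nonempty tail; hence the singleton is a base case of
-- its own.
am-gm : ∀ xs → length xs ^ length xs * product xs ≤ sum xs ^ length xs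
am-gm []           = ≤-refl
am-gm (x ∷ [])     = ≤-reflexive (identity x)
  where
  identity : ∀ x → 1 * (x * 1) ≡ (x + 0) * 1
  identity = solve-∀
am-gm (x ∷ ys@(_ ∷ _)) = *-cancelˡ-≤ (n ^ n) {{m^n≢0 n n}} (begin
  n ^ n * (suc n ^ suc n * (x * product ys))   ≡⟨ shuffle (n ^ n) (suc n ^ suc n) x (product ys) ⟩
  suc n ^ suc n * ((n ^ n * product ys) * x)   ≤⟨ *-monoʳ-≤ (suc n ^ suc n) (*-monoˡ-≤ x (am-gm ys)) ⟩
  suc n ^ suc n * (sum ys ^ n * x)             ≤⟨ am-gm-step n (sum ys) x ⟩
  n ^ n * (sum ys + x) ^ suc n                 ≡⟨ cong (λ z → n ^ n * z ^ suc n) (+-comm (sum ys) x) ⟩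
  n ^ n * (x + sum ys) ^ suc n                 ∎)
  where
  open ≤-Reasoning
  n = length ys
  shuffle : ∀ a b c d → a * (b * (c * d)) ≡ b * ((a * d) * c)
  shuffle = solve-∀

sum-replicate : ∀ n x → sum (replicate n x) ≡ n * x
sum-replicate zero    x = refl
sum-replicate (suc n) x = cong (x +_) (sum-replicate n x)

product-replicate : ∀ n x → product (replicate n x) ≡ x ^ n
product-replicate zero    x = refl
product-replicate (suc n) x = cong (x *_) (product-replicate n x)

weighted-am-gm : ∀ a b x y → (a + b) ^ (a + b) * (x ^ a * y ^ b) ≤ (a * x + b * y) ^ (a + b)
weighted-am-gm a b x y = subst₂ _≤_
  (cong₂ (λ l p → l ^ l * p) len
     (trans (product-++ (replicate a x) _) (cong₂ _*_ (product-replicate a x) (product-replicate b y))))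
  (cong₂ _^_ (trans (sum-++ (replicate a x) _) (cong₂ _+_ (sum-replicate a x) (sum-replicate b y))) len)
  (am-gm (replicate a x ++ replicate b y))
  where
  len = trans (length-++ (replicate a x)) (cong₂ _+_ (length-replicate a) (length-replicate b))

-- `weighted-am-gm` with x = b and y = n a.
entropy-two : ∀ n a b → (a + b) ^ (a + b) * n ^ b ≤ suc n ^ (a + b) * (a ^ a * b ^ b)
entropy-two n a zero rewrite +-identityʳ a | *-identityʳ (a ^ a) = m≤n*m (a ^ a) (suc n ^ a) {{m^n≢0 (suc n) a}}
entropy-two n zero b@(suc _) = subst₂ _≤_ (*-comm (n ^ b) (b ^ b)) (cong (suc n ^ b *_) (sym (*-identityˡ (b ^ b)))) (*-monoˡ-≤ (b ^ b) (^-monoˡ-≤ b (n≤1+n n)))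
entropy-two n a@(suc _) b@(suc _) = *-cancelʳ-≤ _ _ (b ^ a * a ^ b) {{m*n≢0 _ _ {{m^n≢0 b a}} {{m^n≢0 a b}}}} (begin
  ((a + b) ^ (a + b) * n ^ b) * (b ^ a * a ^ b)    ≡⟨ shuffle ((a + b) ^ (a + b)) (n ^ b) (b ^ a) (a ^ b) ⟩
  (a + b) ^ (a + b) * (b ^ a * (n ^ b * a ^ b))    ≡⟨ cong (λ p → (a + b) ^ (a + b) * (b ^ a * p)) (^-distribʳ-* n a b) ⟨
  (a + b) ^ (a + b) * (b ^ a * (n * a) ^ b)        ≤⟨ weighted-am-gm a b b (n * a) ⟩
  (a * b + b * (n * a)) ^ (a + b)                  ≡⟨ cong (_^ (a + b)) (factor a b n) ⟩
  (suc n * (a * b)) ^ (a + b)                      ≡⟨ ^-distribʳ-* (suc n) (a * b) (a + b) ⟩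
  suc n ^ (a + b) * (a * b) ^ (a + b)              ≡⟨ cong (suc n ^ (a + b) *_) (trans (^-distribʳ-* a b (a + b)) (cong₂ _*_ (^-distribˡ-+-* a a b) (^-distribˡ-+-* b a b))) ⟩
  suc n ^ (a + b) * ((a ^ a * a ^ b) * (b ^ a * b ^ b))  ≡⟨ shuffle′ (suc n ^ (a + b)) (a ^ a) (a ^ b) (b ^ a) (b ^ b) ⟩
  (suc n ^ (a + b) * (a ^ a * b ^ b)) * (b ^ a * a ^ b)  ∎)
  where
  open ≤-Reasoning
  shuffle : ∀ p r u v → (p * r) * (u * v) ≡ p * (u * (r * v))
  shuffle = solve-∀
  factor : ∀ a b n → a * b + b * (n * a) ≡ suc n * (a * b)
  factor = solve-∀
  shuffle′ : ∀ s p r u v → s * ((p * r) * (u * v)) ≡ (s * (p * v)) * (u * r)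
  shuffle′ = solve-∀

-- (1 + 1/m)^m is increasing in m.
euler-mono : ∀ m .{{_ : NonZero m}} d → (m + d) ^ (m + d) * suc m ^ m ≤ m ^ m * suc (m + d) ^ (m + d)
euler-mono m d = *-cancelʳ-≤ _ _ (m ^ d) {{m^n≢0 m d}} (begin
  ((m + d) ^ (m + d) * suc m ^ m) * m ^ d       ≡⟨ *-assoc ((m + d) ^ (m + d)) _ _ ⟩
  (m + d) ^ (m + d) * (suc m ^ m * m ^ d)       ≤⟨ weighted-am-gm m d (suc m) m ⟩
  (m * suc m + d * m) ^ (m + d)                 ≡⟨ cong (_^ (m + d)) (factor m d) ⟩
  (m * suc (m + d)) ^ (m + d)                   ≡⟨ ^-distribʳ-* m (suc (m + d)) (m + d) ⟩
  m ^ (m + d) * suc (m + d) ^ (m + d)           ≡⟨ cong (_* suc (m + d) ^ (m + d)) (^-distribˡ-+-* m m d) ⟩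
  (m ^ m * m ^ d) * suc (m + d) ^ (m + d)       ≡⟨ shuffle (m ^ m) (m ^ d) _ ⟩
  (m ^ m * suc (m + d) ^ (m + d)) * m ^ d       ∎)
  where
  open ≤-Reasoning
  factor : ∀ m d → m * suc m + d * m ≡ m * suc (m + d)
  factor = solve-∀
  shuffle : ∀ p r u → (p * r) * u ≡ (p * u) * r
  shuffle = solve-∀

n!≤n^n : ∀ n → n ! ≤ n ^ n
n!≤n^n zero    = ≤-refl
n!≤n^n (suc n) = *-monoʳ-≤ (suc n) (≤-trans (n!≤n^n n) (^-monoˡ-≤ n (n≤1+n n)))

-- Passing from l to l + 1 multiplies l!/l^l by (l/(l + 1))^l, which by `euler-mono` is at most
-- (m/(m + 1))^m once l ≥ m.
factorial-bound : ∀ m .{{_ : NonZero m}} d → (m + d) ! * (suc m ^ m) ^ d ≤ (m + d) ^ (m + d) * (m ^ m) ^ d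
factorial-bound m zero    rewrite +-identityʳ m | *-identityʳ (m !) | *-identityʳ (m ^ m) = n!≤n^n m
factorial-bound m (suc d) rewrite +-suc m d = begin
  (suc l * l !) * (a * a ^ d)                  ≡⟨ shuffle (suc l) (l !) a (a ^ d) ⟩
  suc l * ((l ! * a ^ d) * a)                  ≤⟨ *-monoʳ-≤ (suc l) (*-monoˡ-≤ a (factorial-bound m d)) ⟩
  suc l * ((l ^ l * b ^ d) * a)                ≡⟨ shuffle′ (suc l) (l ^ l) (b ^ d) a ⟩
  suc l * (b ^ d * (l ^ l * a))                ≤⟨ *-monoʳ-≤ (suc l) (*-monoʳ-≤ (b ^ d) (euler-mono m d)) ⟩
  suc l * (b ^ d * (b * suc l ^ l))            ≡⟨ shuffle″ (suc l) (b ^ d) b (suc l ^ l) ⟩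
  (suc l * suc l ^ l) * (b * b ^ d)            ∎
  where
  open ≤-Reasoning
  l = m + d
  a = suc m ^ m
  b = m ^ m
  shuffle : ∀ p r u v → (p * r) * (u * v) ≡ p * ((r * v) * u)
  shuffle = solve-∀
  shuffle′ : ∀ p r u v → p * ((r * u) * v) ≡ p * (u * (r * v))
  shuffle′ = solve-∀
  shuffle″ : ∀ p r u v → p * (r * (u * v)) ≡ (p * v) * (u * r)
  shuffle″ = solve-∀

-- Bernoulli's inequality (1 + 1/x)^l ≥ 1 + l/x with denominators cleared. This unbounded growth in
-- l later pays for a constant factor.
bernoulli-linear : ∀ x l → x ^ l * (x + l) ≤ x * suc x ^ l
bernoulli-linear x zero    = ≤-reflexive (identity x)
  where
  identity : ∀ x → 1 * (x + 0) ≡ x * 1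
  identity = solve-∀
bernoulli-linear x (suc l) = begin
  (x * x ^ l) * (x + suc l)                     ≤⟨ m≤m+n _ (x ^ l * l) ⟩
  (x * x ^ l) * (x + suc l) + x ^ l * l         ≡⟨ identity x (x ^ l) l ⟩
  suc x * (x ^ l * (x + l))                     ≤⟨ *-monoʳ-≤ (suc x) (bernoulli-linear x l) ⟩
  suc x * (x * suc x ^ l)                       ≡⟨ rotate (suc x) x (suc x ^ l) ⟩
  x * (suc x * suc x ^ l)                       ∎
  where
  open ≤-Reasoning
  identity : ∀ x p l → (x * p) * (x + suc l) + p * l ≡ suc x * (p * (x + l))
  identity = solve-∀
  rotate : ∀ p r u → p * (r * u) ≡ r * (p * u)
  rotate = solve-∀

-- Sums and products over lists

private variable
  A B : Set
  P Q : Set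

-- Sums carry expectations and double counts, products carry averages of logarithms; both need the
-- same exchange and fibre laws.
module BigOperator (_∙_ : ℕ → ℕ → ℕ) (ε : ℕ) (isCM : IsCommutativeMonoid _≡_ _∙_ ε) where
  open IsCommutativeMonoid isCM using (assoc; comm; identityˡ; identityʳ)

  big : List A → (A → ℕ) → ℕ
  big []       f = ε
  big (x ∷ xs) f = f x ∙ big xs f

  congruence : ∀ (xs : List A) {f g} → (∀ {x} → x ∈ xs → f x ≡ g x) → big xs f ≡ big xs g
  congruence []       f≡g = refl
  congruence (x ∷ xs) f≡g = cong₂ _∙_ (f≡g (here refl)) (congruence xs λ x∈ → f≡g (there x∈))

  unit : ∀ (xs : List A) → big xs (λ _ → ε) ≡ ε
  unit []       = refl
  unit (x ∷ xs) = trans (identityˡ _) (unit xs)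

  interchange : ∀ a b c d → (a ∙ b) ∙ (c ∙ d) ≡ (a ∙ c) ∙ (b ∙ d)
  interchange a b c d = begin
    (a ∙ b) ∙ (c ∙ d)  ≡⟨ assoc a b _ ⟩
    a ∙ (b ∙ (c ∙ d))  ≡⟨ cong (a ∙_) (assoc b c d) ⟨
    a ∙ ((b ∙ c) ∙ d)  ≡⟨ cong (λ z → a ∙ (z ∙ d)) (comm b c) ⟩
    a ∙ ((c ∙ b) ∙ d)  ≡⟨ cong (a ∙_) (assoc c b d) ⟩
    a ∙ (c ∙ (b ∙ d))  ≡⟨ assoc a c _ ⟨
    (a ∙ c) ∙ (b ∙ d)  ∎
    where open ≡-Reasoning

  merge : ∀ (xs : List A) f g → big xs (λ x → f x ∙ g x) ≡ big xs f ∙ big xs g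
  merge []       f g = sym (identityˡ ε)
  merge (x ∷ xs) f g = trans (cong ((f x ∙ g x) ∙_) (merge xs f g)) (interchange (f x) (g x) _ _)

  exchange : ∀ (xs : List A) (ys : List B) (f : A → B → ℕ) → big xs (λ x → big ys (f x)) ≡ big ys (λ y → big xs (λ x → f x y))
  exchange []       ys f = sym (unit ys)
  exchange (x ∷ xs) ys f = trans (cong (big ys (f x) ∙_) (exchange xs ys f)) (sym (merge ys _ _))

  big-++ : ∀ (xs ys : List A) f → big (xs ++ ys) f ≡ big xs f ∙ big ys f
  big-++ []       ys f = sym (identityˡ _)
  big-++ (x ∷ xs) ys f = trans (cong (f x ∙_) (big-++ xs ys f)) (sym (assoc (f x) _ _))

  big-map : ∀ (h : A → B) xs f → big (map h xs) f ≡ big xs (λ x → f (h x))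
  big-map h []       f = refl
  big-map h (x ∷ xs) f = cong (f (h x) ∙_) (big-map h xs f)

  big-concatMap : ∀ (h : A → List B) xs f → big (concatMap h xs) f ≡ big xs (λ x → big (h x) f)
  big-concatMap h []       f = refl
  big-concatMap h (x ∷ xs) f = trans (big-++ (h x) _ f) (cong (big (h x) f ∙_) (big-concatMap h xs f))

  big-filter : ∀ {R : Pred A 0ℓ} (R? : Decidable R) xs f →
               big (filter R? xs) f ≡ big xs (λ x → if does (R? x) then f x else ε)
  big-filter R? []       f = refl
  big-filter R? (x ∷ xs) f with does (R? x)
  ... | true  = cong (f x ∙_) (big-filter R? xs f)
  ... | false = trans (big-filter R? xs f) (sym (identityˡ _))

  big-↭ : ∀ {xs ys : List A} f → xs ↭ ys → big xs f ≡ big ys f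
  big-↭ f Perm.refl        = refl
  big-↭ f (prep x p)       = cong (f x ∙_) (big-↭ f p)
  big-↭ {xs = _ ∷ _ ∷ _} {ys = _ ∷ _ ∷ ys} f (swap x y p) = trans (cong (λ z → f x ∙ (f y ∙ z)) (big-↭ f p))
                               (trans (sym (assoc (f x) (f y) _)) (trans (cong (_∙ big ys f) (comm (f x) (f y))) (assoc (f y) (f x) _)))
  big-↭ f (Perm.trans p r) = trans (big-↭ f p) (big-↭ f r)

  big-single : ∀ {q} (i : Fin q) (h : Fin q → ℕ) →
               big (allFinL q) (λ c → if does (i ≟ c) then h c else ε) ≡ h i
  big-single {suc q} Fin.zero h = begin
    h Fin.zero ∙ big (map Fin.suc (allFinL q)) _  ≡⟨ cong (h Fin.zero ∙_) (big-map Fin.suc (allFinL q) _) ⟩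
    h Fin.zero ∙ big (allFinL q) (λ _ → ε)        ≡⟨ cong (h Fin.zero ∙_) (unit (allFinL q)) ⟩
    h Fin.zero ∙ ε                                ≡⟨ identityʳ _ ⟩
    h Fin.zero                                    ∎
    where open ≡-Reasoning
  big-single {suc q} (Fin.suc i) h = begin
    ε ∙ big (map Fin.suc (allFinL q)) _           ≡⟨ identityˡ _ ⟩
    big (map Fin.suc (allFinL q)) _               ≡⟨ big-map Fin.suc (allFinL q) _ ⟩
    big (allFinL q) (λ c → if does (i ≟ c) then h (Fin.suc c) else ε)  ≡⟨ big-single i (λ c → h (Fin.suc c)) ⟩
    h (Fin.suc i)                                 ∎
    where open ≡-Reasoning

  big-fibres : ∀ {q} (φ : A → Fin q) xs h →
               big (allFinL q) (λ c → big (filter (λ x → φ x ≟ c) xs) h) ≡ big xs h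
  big-fibres {q = q} φ xs h = begin
    big (allFinL q) (λ c → big (filter (λ x → φ x ≟ c) xs) h)                  ≡⟨ congruence (allFinL q) (λ {c} _ → big-filter (λ x → φ x ≟ c) xs h) ⟩
    big (allFinL q) (λ c → big xs (λ x → if does (φ x ≟ c) then h x else ε))   ≡⟨ exchange (allFinL q) xs _ ⟩
    big xs (λ x → big (allFinL q) (λ c → if does (φ x ≟ c) then h x else ε))   ≡⟨ congruence xs (λ {x} _ → big-single (φ x) (λ _ → h x)) ⟩
    big xs h                                                                   ∎
    where open ≡-Reasoning

  big-allVecs : ∀ q E f → big (allVecs q (suc E)) f ≡ big (allFinL q) (λ x → big (allVecs q E) (λ v → f (x ∷ v)))
  big-allVecs q E f = trans (big-concatMap _ (allFinL q) f) (congruence (allFinL q) λ {x} _ → big-map (x ∷_) (allVecs q E) f)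

open module ∑ = BigOperator _+_ 0 +-0-isCommutativeMonoid using () renaming (big to ∑)
open module ∏ = BigOperator _*_ 1 *-1-isCommutativeMonoid using () renaming (big to ∏)

∑-mono : ∀ (xs : List A) {f g} → (∀ {x} → x ∈ xs → f x ≤ g x) → ∑ xs f ≤ ∑ xs g
∑-mono []       f≤g = z≤n
∑-mono (x ∷ xs) f≤g = +-mono-≤ (f≤g (here refl)) (∑-mono xs λ x∈ → f≤g (there x∈))

∏-mono : ∀ (xs : List A) {f g} → (∀ {x} → x ∈ xs → f x ≤ g x) → ∏ xs f ≤ ∏ xs g
∏-mono []       f≤g = ≤-refl
∏-mono (x ∷ xs) f≤g = *-mono-≤ (f≤g (here refl)) (∏-mono xs λ x∈ → f≤g (there x∈))

*-distribˡ-∑ : ∀ c (xs : List A) f → c * ∑ xs f ≡ ∑ xs (λ x → c * f x)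
*-distribˡ-∑ c []       f = *-zeroʳ c
*-distribˡ-∑ c (x ∷ xs) f = trans (*-distribˡ-+ c (f x) _) (cong (c * f x +_) (*-distribˡ-∑ c xs f))

*-distribʳ-∑ : ∀ c (xs : List A) f → ∑ xs f * c ≡ ∑ xs (λ x → f x * c)
*-distribʳ-∑ c []       f = refl
*-distribʳ-∑ c (x ∷ xs) f = trans (*-distribʳ-+ c (f x) _) (cong (f x * c +_) (*-distribʳ-∑ c xs f))

∑-const : ∀ (xs : List A) c → ∑ xs (λ _ → c) ≡ length xs * c
∑-const []       c = refl
∑-const (x ∷ xs) c = cong (c +_) (∑-const xs c)

∏-const : ∀ (xs : List A) c → ∏ xs (λ _ → c) ≡ c ^ length xs
∏-const []       c = refl
∏-const (x ∷ xs) c = cong (c *_) (∏-const xs c)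

∏-^ : ∀ (xs : List A) f c → ∏ xs (λ x → f x ^ c) ≡ ∏ xs f ^ c
∏-^ []       f c = sym (^-zeroˡ c)
∏-^ (x ∷ xs) f c = trans (cong (f x ^ c *_) (∏-^ xs f c)) (sym (^-distribʳ-* (f x) _ c))

∏-^-∑ : ∀ (xs : List A) c f → ∏ xs (λ x → c ^ f x) ≡ c ^ ∑ xs f
∏-^-∑ []       c f = refl
∏-^-∑ (x ∷ xs) c f = trans (cong (c ^ f x *_) (∏-^-∑ xs c f)) (sym (^-distribˡ-+-* c (f x) _))

∏-nonZero : ∀ (xs : List A) {f} → (∀ x → NonZero (f x)) → NonZero (∏ xs f)
∏-nonZero []       f≢0 = _
∏-nonZero (x ∷ xs) f≢0 = m*n≢0 _ _ {{f≢0 x}} {{∏-nonZero xs f≢0}}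

term≤∑ : ∀ {xs : List A} f {x} → x ∈ xs → f x ≤ ∑ xs f
term≤∑ f (here refl)  = m≤m+n _ _
term≤∑ f (there x∈xs) = ≤-trans (term≤∑ f x∈xs) (m≤n+m _ _)

sum-map : ∀ (xs : List A) f → sum (map f xs) ≡ ∑ xs f
sum-map []       f = refl
sum-map (x ∷ xs) f = cong (f x +_) (sum-map xs f)

product-map : ∀ (xs : List A) f → product (map f xs) ≡ ∏ xs f
product-map []       f = refl
product-map (x ∷ xs) f = cong (f x *_) (product-map xs f)

am-gm-∑ : ∀ (xs : List A) f → length xs ^ length xs * ∏ xs f ≤ ∑ xs f ^ length xs
am-gm-∑ xs f = subst₂ _≤_
  (cong₂ (λ l p → l ^ l * p) (length-map f xs) (product-map xs f))
  (cong₂ _^_ (sum-map xs f) (length-map f xs))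
  (am-gm (map f xs))

-- Indicators and enumerations

𝟙 : Dec P → ℕ
𝟙 d = if does d then 1 else 0

𝟙-yes : (d : Dec P) → P → 𝟙 d ≡ 1
𝟙-yes (yes _) p = refl
𝟙-yes (no ¬p) p = contradiction p ¬p

𝟙-mono : (d : Dec P) (d′ : Dec Q) → (P → Q) → 𝟙 d ≤ 𝟙 d′
𝟙-mono (no _)  d′ f = z≤n
𝟙-mono (yes p) d′ f = ≤-reflexive (sym (𝟙-yes d′ (f p)))

𝟙≤1 : (d : Dec P) → 𝟙 d ≤ 1
𝟙≤1 (no _)  = z≤n
𝟙≤1 (yes _) = ≤-refl

∈-allFinL : ∀ {q} (i : Fin q) → i ∈ allFinL q
∈-allFinL Fin.zero    = here refl
∈-allFinL (Fin.suc i) = there (∈-map⁺ Fin.suc (∈-allFinL i))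

length-allFinL : ∀ q → length (allFinL q) ≡ q
length-allFinL zero    = refl
length-allFinL (suc q) = cong suc (trans (length-map Fin.suc (allFinL q)) (length-allFinL q))

length-∑ : ∀ (xs : List A) → length xs ≡ ∑ xs (λ _ → 1)
length-∑ []       = refl
length-∑ (x ∷ xs) = cong suc (length-∑ xs)

length-allVecs : ∀ q E → length (allVecs q E) ≡ q ^ E
length-allVecs q zero    = refl
length-allVecs q (suc E) = begin
  length (allVecs q (suc E))                               ≡⟨ length-∑ (allVecs q (suc E)) ⟩
  ∑ (allVecs q (suc E)) (λ _ → 1)                          ≡⟨ ∑.big-allVecs q E _ ⟩
  ∑ (allFinL q) (λ _ → ∑ (allVecs q E) (λ _ → 1))          ≡⟨ ∑-const (allFinL q) _ ⟩
  length (allFinL q) * ∑ (allVecs q E) (λ _ → 1)           ≡⟨ cong₂ _*_ (length-allFinL q) (trans (sym (length-∑ (allVecs q E))) (length-allVecs q E)) ⟩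
  q * q ^ E                                                ∎
  where open ≡-Reasoning

-- Independence of the coordinates of a uniform random vector: the expectation of a product of
-- functions of separate coordinates factorises.
∑-∏-allVecs : ∀ q E (g : Fin E → Fin q → ℕ) →
  ∑ (allVecs q E) (λ v → ∏ (allFinL E) (λ i → g i (lookup v i))) ≡ ∏ (allFinL E) (λ i → ∑ (allFinL q) (g i))
∑-∏-allVecs q zero    g = refl
∑-∏-allVecs q (suc E) g = begin
  ∑ (allVecs q (suc E)) (λ v → ∏ (allFinL (suc E)) (λ i → g i (lookup v i)))
    ≡⟨ ∑.big-allVecs q E _ ⟩
  ∑ (allFinL q) (λ x → ∑ (allVecs q E) (λ v → g Fin.zero x * ∏ (map Fin.suc (allFinL E)) (λ i → g i (lookup (x ∷ v) i))))
    ≡⟨ ∑.congruence (allFinL q) (λ {x} _ → ∑.congruence (allVecs q E) λ {v} _ → cong (g Fin.zero x *_) (∏.big-map Fin.suc (allFinL E) _)) ⟩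
  ∑ (allFinL q) (λ x → ∑ (allVecs q E) (λ v → g Fin.zero x * ∏ (allFinL E) (λ i → g (Fin.suc i) (lookup v i))))
    ≡⟨ ∑.congruence (allFinL q) (λ {x} _ → sym (*-distribˡ-∑ (g Fin.zero x) (allVecs q E) _)) ⟩
  ∑ (allFinL q) (λ x → g Fin.zero x * ∑ (allVecs q E) (λ v → ∏ (allFinL E) (λ i → g (Fin.suc i) (lookup v i))))
    ≡⟨ *-distribʳ-∑ _ (allFinL q) (g Fin.zero) ⟨
  ∑ (allFinL q) (g Fin.zero) * ∑ (allVecs q E) (λ v → ∏ (allFinL E) (λ i → g (Fin.suc i) (lookup v i)))
    ≡⟨ cong (∑ (allFinL q) (g Fin.zero) *_) (∑-∏-allVecs q E (λ i → g (Fin.suc i))) ⟩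
  ∑ (allFinL q) (g Fin.zero) * ∏ (allFinL E) (λ i → ∑ (allFinL q) (g (Fin.suc i)))
    ≡⟨ cong (∑ (allFinL q) (g Fin.zero) *_) (∏.big-map Fin.suc (allFinL E) _) ⟨
  ∏ (allFinL (suc E)) (λ i → ∑ (allFinL q) (g i)) ∎
  where open ≡-Reasoning

-- Each value stands at coordinate `e` in q^(E - 1) vectors; the extra power `q` on the left avoids
-- the subtraction in the exponent.
∏-lookup : ∀ q {E} (g : Fin q → ℕ) (e : Fin E) →
  ∏ (allVecs q E) (λ v → g (lookup v e)) ^ q ≡ ∏ (allFinL q) g ^ (q ^ E)
∏-lookup q {suc E} g Fin.zero = begin
  ∏ (allVecs q (suc E)) (λ v → g (lookup v Fin.zero)) ^ q        ≡⟨ cong (_^ q) (∏.big-allVecs q E _) ⟩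
  ∏ (allFinL q) (λ x → ∏ (allVecs q E) (λ _ → g x)) ^ q          ≡⟨ cong (_^ q) (∏.congruence (allFinL q) λ {x} _ → trans (∏-const (allVecs q E) (g x)) (cong (g x ^_) (length-allVecs q E))) ⟩
  ∏ (allFinL q) (λ x → g x ^ (q ^ E)) ^ q                        ≡⟨ cong (_^ q) (∏-^ (allFinL q) g (q ^ E)) ⟩
  (∏ (allFinL q) g ^ (q ^ E)) ^ q                                ≡⟨ ^-*-assoc _ (q ^ E) q ⟩
  ∏ (allFinL q) g ^ (q ^ E * q)                                  ≡⟨ cong (∏ (allFinL q) g ^_) (*-comm (q ^ E) q) ⟩
  ∏ (allFinL q) g ^ (q * q ^ E)                                  ∎
  where open ≡-Reasoning
∏-lookup q {suc E} g (Fin.suc e) = begin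
  ∏ (allVecs q (suc E)) (λ v → g (lookup v (Fin.suc e))) ^ q     ≡⟨ cong (_^ q) (∏.big-allVecs q E _) ⟩
  ∏ (allFinL q) (λ _ → ∏ (allVecs q E) (λ v → g (lookup v e))) ^ q   ≡⟨ cong (_^ q) (trans (∏-const (allFinL q) _) (cong (∏ (allVecs q E) (λ v → g (lookup v e)) ^_) (length-allFinL q))) ⟩
  (∏ (allVecs q E) (λ v → g (lookup v e)) ^ q) ^ q               ≡⟨ cong (_^ q) (∏-lookup q g e) ⟩
  (∏ (allFinL q) g ^ (q ^ E)) ^ q                                ≡⟨ ^-*-assoc _ (q ^ E) q ⟩
  ∏ (allFinL q) g ^ (q ^ E * q)                                  ≡⟨ cong (∏ (allFinL q) g ^_) (*-comm (q ^ E) q) ⟩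
  ∏ (allFinL q) g ^ (q * q ^ E)                                  ∎
  where open ≡-Reasoning

∏-falling : ∀ L → ∏ (allFinL L) (λ j → L ∸ Fin.toℕ j) ≡ L !
∏-falling zero    = refl
∏-falling (suc L) = cong (suc L *_) (trans (∏.big-map Fin.suc (allFinL L) _) (∏-falling L))

-- The entropy chain rule

n^n≢0 : ∀ n → NonZero (n ^ n)
n^n≢0 zero      = _
n^n≢0 n@(suc _) = m^n≢0 n n

-- In logarithms: the entropy of the distribution proportional to `a` is at most the logarithm of
-- the size of its support. Elements are split off one at a time, and `entropy-two` pays for
-- enlarging the support from n to n + 1.
entropy-∑ : ∀ (cs : List A) (a : A → ℕ) →
  ∑ cs a ^ ∑ cs a ≤ ∑ cs (λ c → 𝟙 (0 <? a c)) ^ ∑ cs a * ∏ cs (λ c → a c ^ a c)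
entropy-∑ []       a = ≤-refl
entropy-∑ (c ∷ cs) a with a c | entropy-∑ cs a
... | zero      | ih = subst (λ z → ∑ cs a ^ ∑ cs a ≤ ∑ cs (λ c → 𝟙 (0 <? a c)) ^ ∑ cs a * z) (sym (*-identityˡ _)) ih
... | x@(suc _) | ih = *-cancelʳ-≤ _ _ (n ^ y) {{n^y≢0}} (begin
  (x + y) ^ (x + y) * n ^ y                        ≤⟨ entropy-two n x y ⟩
  suc n ^ (x + y) * (x ^ x * y ^ y)                ≤⟨ *-monoʳ-≤ (suc n ^ (x + y)) (*-monoʳ-≤ (x ^ x) ih) ⟩
  suc n ^ (x + y) * (x ^ x * (n ^ y * p))          ≡⟨ shuffle (suc n ^ (x + y)) (x ^ x) (n ^ y) p ⟩
  (suc n ^ (x + y) * (x ^ x * p)) * n ^ y          ∎)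
  where
  open ≤-Reasoning
  n = ∑ cs (λ c → 𝟙 (0 <? a c))
  y = ∑ cs a
  p = ∏ cs (λ c → a c ^ a c)
  shuffle : ∀ s u v w → s * (u * (v * w)) ≡ (s * (u * w)) * v
  shuffle = solve-∀
  -- `y ^ y` is positive even for y = 0, and the induction hypothesis bounds it by a multiple of
  -- `n ^ y`.
  n^y≢0 : NonZero (n ^ y)
  n^y≢0 = m*n≢0⇒m≢0 (n ^ y) {{>-nonZero (<-≤-trans (>-nonZero⁻¹ (y ^ y) {{n^n≢0 y}}) ih)}}

unique-allFinL : ∀ q → Unique (allFinL q)
unique-allFinL zero    = []
unique-allFinL (suc q) = All.map⁺ (All.universal (λ _ ()) (allFinL q)) ∷ Unique.map⁺ (λ { refl → refl }) (unique-allFinL q)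

unique-allVecs : ∀ q E → Unique (allVecs q E)
unique-allVecs q zero    = [] ∷ []
unique-allVecs q (suc E) = Unique.concat⁺
  (All.map⁺ (All.universal (λ x → Unique.map⁺ ∷-injectiveʳ (unique-allVecs q E)) (allFinL q)))
  (AllPairs.map⁺ (AllPairs.map (λ x≢y {_} (v∈x , v∈y) → x≢y (heads v∈x v∈y)) (unique-allFinL q)))
  where
  heads : ∀ {x y v} → v ∈ map (x ∷_) (allVecs q E) → v ∈ map (y ∷_) (allVecs q E) → x ≡ y
  heads v∈x v∈y with ∈-map⁻ _ v∈x | ∈-map⁻ _ v∈y
  ... | _ , _ , eq | _ , _ , eq′ = ∷-injectiveˡ (trans (sym eq) eq′)

lookup-injective : ∀ {n} {u v : Vec A n} → (∀ i → lookup u i ≡ lookup v i) → u ≡ v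
lookup-injective {u = u} {v} u≗v = trans (sym (tabulate∘lookup u)) (trans (tabulate-cong u≗v) (tabulate∘lookup v))

nonempty : ∀ (xs : List A) → 0 < length xs → ∃ (_∈ xs)
nonempty (x ∷ xs) _ = x , here refl

-- Edges of the same level as e, and e itself, do not exclude any colour.
Available : ∀ {n E q} → Hypergraph n E → (Fin E → ℕ) → Fin E → Vec (Fin q) E → Fin q → Set
Available {E = E} G level e X c = (f : Fin E) → Share G e f → lookup X f ≡ c → level e ≤ level f

available? : ∀ {n E q} (G : Hypergraph n E) level e (X : Vec (Fin q) E) c → Dec (Available G level e X c)
available? G level e X c = all? λ f → share? G e f →-dec (lookup X f ≟ c →-dec level e ≤? level f)

available : ∀ {n E q} → Hypergraph n E → (Fin E → ℕ) → Fin E → Vec (Fin q) E → ℕ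
available {q = q} G level e X = ∑ (allFinL q) (λ c → 𝟙 (available? G level e X c))

properColourings : ∀ {n E} → Hypergraph n E → (q : ℕ) → List (Vec (Fin q) E)
properColourings {E = E} G q = filter (proper? G) (allVecs q E)

module _ {n E q : ℕ} (G : Hypergraph n E) (level : Fin E → ℕ) where

  -- The chain rule for the entropy of a uniform element of S, whose elements agree outside es.
  chain-rule : ∀ es → AllPairs (λ e f → level e ≤ level f) es →
    (S : List (Vec (Fin q) E)) → Unique S → All (Proper G) S →
    (∀ {X Y} → X ∈ S → Y ∈ S → ∀ f → f ∉ es → lookup X f ≡ lookup Y f) →
    length S ^ length S ≤ ∏ S (λ X → ∏ es (λ e → available G level e X))
  chain-rule [] _ []          _ _ _ = ≤-refl
  chain-rule [] _ (X ∷ [])    _ _ _ = ≤-refl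
  -- No edge is left on which two colourings could differ, so distinct ones cannot coexist.
  chain-rule [] _ (X ∷ Y ∷ S) ((X≢Y ∷ _) ∷ _) _ agree =
    contradiction (lookup-injective λ f → agree (here refl) (there (here refl)) f λ ()) X≢Y
  chain-rule (e ∷ es) (e≤es ∷ sorted) S unique proper agree = begin
    length S ^ length S                                         ≡⟨ cong (λ z → z ^ z) ∑a≡length ⟨
    -- The colour of `e` takes `N` values and so has entropy at most log N; what remains is the
    -- entropy inside the fibres.
    ∑ (allFinL q) a ^ ∑ (allFinL q) a                           ≤⟨ entropy-∑ (allFinL q) a ⟩
    N ^ ∑ (allFinL q) a * ∏ (allFinL q) (λ c → a c ^ a c)       ≡⟨ cong (λ z → N ^ z * ∏ (allFinL q) (λ c → a c ^ a c)) ∑a≡length ⟩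
    N ^ length S * ∏ (allFinL q) (λ c → a c ^ a c)              ≡⟨ cong (_* ∏ (allFinL q) (λ c → a c ^ a c)) (∏-const S N) ⟨
    ∏ S (λ _ → N) * ∏ (allFinL q) (λ c → a c ^ a c)             ≤⟨ *-mono-≤ (∏-mono S N≤available) (∏-mono (allFinL q) λ {c} _ → recurse c) ⟩
    ∏ S (available G level e) * ∏ (allFinL q) (λ c → ∏ (fibre c) rest)  ≡⟨ cong (∏ S (available G level e) *_) (∏.big-fibres (λ X → lookup X e) S rest) ⟩
    ∏ S (available G level e) * ∏ S rest                        ≡⟨ ∏.merge S (available G level e) rest ⟨
    ∏ S (λ X → ∏ (e ∷ es) (λ f → available G level f X))        ∎
    where
    open ≤-Reasoning
    rest : Vec (Fin q) E → ℕ
    rest X = ∏ es (λ f → available G level f X)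
    fibre : Fin q → List (Vec (Fin q) E)
    fibre c = filter (λ X → lookup X e ≟ c) S
    ∈-fibre : ∀ {c X} → X ∈ fibre c → X ∈ S × lookup X e ≡ c
    ∈-fibre {c} = ∈-filter⁻ (λ X → lookup X e ≟ c)
    a : Fin q → ℕ
    a c = length (fibre c)
    N : ℕ
    N = ∑ (allFinL q) (λ c → 𝟙 (0 <? a c))
    ∑a≡length : ∑ (allFinL q) a ≡ length S
    ∑a≡length = trans (∑.congruence (allFinL q) λ {c} _ → length-∑ (fibre c))
                  (trans (∑.big-fibres (λ X → lookup X e) S (λ _ → 1)) (sym (length-∑ S)))
    agree′ : ∀ {c X Y} → X ∈ fibre c → Y ∈ fibre c → ∀ f → f ∉ es → lookup X f ≡ lookup Y f
    agree′ X∈ Y∈ f f∉es with f ≟ e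
    ... | yes refl = trans (proj₂ (∈-fibre X∈)) (sym (proj₂ (∈-fibre Y∈)))
    ... | no  f≢e  = agree (proj₁ (∈-fibre X∈)) (proj₁ (∈-fibre Y∈)) f
                       λ { (here f≡e) → f≢e f≡e ; (there f∈es) → f∉es f∈es }
    recurse : ∀ c → a c ^ a c ≤ ∏ (fibre c) rest
    recurse c = chain-rule es sorted (fibre c) (Unique.filter⁺ (λ X → lookup X e ≟ c) unique)
                  (All.filter⁺ (λ X → lookup X e ≟ c) proper) agree′
    -- Every colour that occurs at `e` within S is available with respect to every X in S. A
    -- neighbour f that excluded it would have smaller level, hence lie outside `e ∷ es`; there X
    -- and Y agree, so Y would give e and f the same colour.
    attained : ∀ {X Y} → X ∈ S → Y ∈ S → Available G level e X (lookup Y e)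
    attained {X} {Y} X∈S Y∈S f e~f Xf≡Ye with _∈?_ _≟_ f (e ∷ es)
    ... | yes (here refl)  = ≤-refl
    ... | yes (there f∈es) = All.lookup e≤es f∈es
    ... | no  f∉           = contradiction (trans (sym Xf≡Ye) (agree X∈S Y∈S f f∉))
                               (All.lookup proper Y∈S e f (λ { refl → f∉ (here refl) }) e~f)
    N≤available : ∀ {X} → X ∈ S → N ≤ available G level e X
    N≤available {X} X∈S = ∑-mono (allFinL q) λ {c} _ → 𝟙-mono (0 <? a c) (available? G level e X c) λ 0<a →
      let Y , Y∈ = nonempty (fibre c) 0<a
          Y∈S , Ye≡c = ∈-fibre Y∈
      in subst (Available G level e X) Ye≡c (attained X∈S Y∈S)

  byLevel : DecTotalOrder _ _ _
  byLevel = On.decTotalOrder ≤-decTotalOrder level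

  open Data.List.Sort byLevel using (sort; sort-↭; sort-↗)

  entropy-bound : let S = properColourings G q in
                  length S ^ length S ≤ ∏ S (λ X → ∏ (allFinL E) (λ e → available G level e X))
  entropy-bound = ≤-trans
    (chain-rule (sort (allFinL E)) (Linked⇒AllPairs (DecTotalOrder.trans byLevel) (sort-↗ (allFinL E))) S
      (Unique.filter⁺ (proper? G) (unique-allVecs q E)) (All.all-filter (proper? G) (allVecs q E))
      λ _ _ f f∉ → contradiction (∈-resp-↭ (↭-sym (sort-↭ (allFinL E))) (∈-allFinL f)) f∉)
    (≤-reflexive (∏.congruence S λ {X} _ → ∏.big-↭ (λ e → available G level e X) (sort-↭ (allFinL E))))
    where
    S = properColourings G q

-- Colour multiplicities around an edge

𝟙-× : (d : Dec P) (d′ : Dec Q) → 𝟙 (d ×-dec d′) ≡ 𝟙 d * 𝟙 d′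
𝟙-× (yes _) (yes _) = refl
𝟙-× (yes _) (no _)  = refl
𝟙-× (no _)  _       = refl

𝟙-no : (d : Dec P) → ¬ P → 𝟙 d ≤ 0
𝟙-no (no _)  ¬p = z≤n
𝟙-no (yes p) ¬p = contradiction p ¬p

∑-𝟙-≟ : ∀ {q} (i : Fin q) → ∑ (allFinL q) (λ j → 𝟙 (i ≟ j)) ≡ 1
∑-𝟙-≟ i = ∑.big-single i (λ _ → 1)

∑-𝟙-subsingleton : ∀ {m} {R : Fin m → Set} (R? : ∀ i → Dec (R i)) → (∀ {i j} → R i → R j → i ≡ j) →
                   ∑ (allFinL m) (λ i → 𝟙 (R? i)) ≤ 1
∑-𝟙-subsingleton {m} R? unique with any? R?
... | yes (i , Ri) = ≤-trans (∑-mono (allFinL m) λ {j} _ → 𝟙-mono (R? j) (i ≟ j) (unique Ri)) (≤-reflexive (∑-𝟙-≟ i))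
... | no  ¬R       = ≤-trans (∑-mono (allFinL m) λ {j} _ → 𝟙-no (R? j) (λ Rj → ¬R (j , Rj)))
                       (≤-trans (≤-reflexive (∑.unit (allFinL m))) z≤n)

countTrue-∑ : ∀ {m} (f : Fin m → Bool) → countTrue f ≡ ∑ (allFinL m) (λ i → if f i then 1 else 0)
countTrue-∑ {zero}  f = refl
countTrue-∑ {suc m} f with f Fin.zero
... | true  = cong suc (trans (countTrue-∑ (λ i → f (Fin.suc i))) (sym (∑.big-map Fin.suc (allFinL m) _)))
... | false = trans (countTrue-∑ (λ i → f (Fin.suc i))) (sym (∑.big-map Fin.suc (allFinL m) _))

∣∣-∑ : ∀ {n} (p : Subset n) → ∣ p ∣ ≡ ∑ (allFinL n) (λ v → 𝟙 (v ∈ˢ? p))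
∣∣-∑ []          = refl
∣∣-∑ {suc n} (true  ∷ p) = cong suc (trans (∣∣-∑ p) (sym (∑.big-map Fin.suc (allFinL n) _)))
∣∣-∑ {suc n} (false ∷ p) = trans (∣∣-∑ p) (sym (∑.big-map Fin.suc (allFinL n) _))

module _ {n E q : ℕ} (G : Hypergraph n E) where

  private
    V  = allFinL n
    Es = allFinL E
    μ : Fin n → Fin E → ℕ
    μ v e = 𝟙 (v ∈ˢ? G e)
    common : Fin n → Fin E → Fin E → ℕ
    common v e f = 𝟙 ((v ∈ˢ? G e) ×-dec (v ∈ˢ? G f))
    δ : Fin n → Fin n → ℕ
    δ u v = 𝟙 (¬? (u ≟ v))

  -- A nonempty `e` counts as its own neighbour, here and in `multiplicity`; this matches the
  -- incidence count `k * D`, which also includes e.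
  neighbours : Fin E → ℕ
  neighbours e = ∑ Es (λ f → 𝟙 (share? G e f))

  multiplicity : Fin E → Vec (Fin q) E → Fin q → ℕ
  multiplicity e X c = ∑ Es (λ f → 𝟙 (share? G e f ×-dec lookup X f ≟ c))

  ∑-multiplicity : ∀ e X → ∑ (allFinL q) (multiplicity e X) ≡ neighbours e
  ∑-multiplicity e X = begin
    ∑ (allFinL q) (multiplicity e X)
      ≡⟨ ∑.exchange (allFinL q) Es _ ⟩
    ∑ Es (λ f → ∑ (allFinL q) (λ c → 𝟙 (share? G e f ×-dec lookup X f ≟ c)))
      ≡⟨ ∑.congruence Es (λ {f} _ → ∑.congruence (allFinL q) λ {c} _ → 𝟙-× (share? G e f) (lookup X f ≟ c)) ⟩
    ∑ Es (λ f → ∑ (allFinL q) (λ c → 𝟙 (share? G e f) * 𝟙 (lookup X f ≟ c)))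
      ≡⟨ ∑.congruence Es (λ {f} _ → sym (*-distribˡ-∑ (𝟙 (share? G e f)) (allFinL q) _)) ⟩
    ∑ Es (λ f → 𝟙 (share? G e f) * ∑ (allFinL q) (λ c → 𝟙 (lookup X f ≟ c)))
      ≡⟨ ∑.congruence Es (λ {f} _ → trans (cong (𝟙 (share? G e f) *_) (∑-𝟙-≟ (lookup X f))) (*-identityʳ _)) ⟩
    neighbours e ∎
    where open ≡-Reasoning

  share≤∑-common : ∀ e f → 𝟙 (share? G e f) ≤ ∑ V (λ v → common v e f)
  share≤∑-common e f with share? G e f
  ... | no _                 = z≤n
  ... | yes (v , v∈e , v∈f)  = ≤-trans (≤-reflexive (sym (𝟙-yes ((v ∈ˢ? G e) ×-dec (v ∈ˢ? G f)) (v∈e , v∈f))))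
                                 (term≤∑ (λ v → common v e f) (∈-allFinL v))

  -- Properness allows at most one edge of colour `c` through each vertex of `e`.
  multiplicity≤size : ∀ e X → Proper G X → ∀ c → multiplicity e X c ≤ ∣ G e ∣
  multiplicity≤size e X proper c = begin
    multiplicity e X c
      ≡⟨ ∑.congruence Es (λ {f} _ → 𝟙-× (share? G e f) (lookup X f ≟ c)) ⟩
    ∑ Es (λ f → 𝟙 (share? G e f) * 𝟙 (lookup X f ≟ c))
      ≤⟨ ∑-mono Es (λ {f} _ → *-monoˡ-≤ (𝟙 (lookup X f ≟ c)) (share≤∑-common e f)) ⟩
    ∑ Es (λ f → ∑ V (λ v → common v e f) * 𝟙 (lookup X f ≟ c))
      ≡⟨ ∑.congruence Es (λ {f} _ → *-distribʳ-∑ (𝟙 (lookup X f ≟ c)) V _) ⟩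
    ∑ Es (λ f → ∑ V (λ v → common v e f * 𝟙 (lookup X f ≟ c)))
      ≡⟨ ∑.exchange Es V _ ⟩
    ∑ V (λ v → ∑ Es (λ f → common v e f * 𝟙 (lookup X f ≟ c)))
      ≡⟨ ∑.congruence V (λ {v} _ → trans (∑.congruence Es λ {f} _ → regroup v f) (sym (*-distribˡ-∑ (μ v e) Es _))) ⟩
    ∑ V (λ v → μ v e * ∑ Es (λ f → 𝟙 ((v ∈ˢ? G f) ×-dec lookup X f ≟ c)))
      ≤⟨ ∑-mono V (λ {v} _ → *-monoʳ-≤ (μ v e) (∑-𝟙-subsingleton (λ f → (v ∈ˢ? G f) ×-dec lookup X f ≟ c) (disjoint v))) ⟩
    ∑ V (λ v → μ v e * 1)
      ≡⟨ ∑.congruence V (λ _ → *-identityʳ _) ⟩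
    ∑ V (λ v → μ v e)
      ≡⟨ ∣∣-∑ (G e) ⟨
    ∣ G e ∣ ∎
    where
    open ≤-Reasoning
    regroup : ∀ v f → common v e f * 𝟙 (lookup X f ≟ c) ≡ μ v e * 𝟙 ((v ∈ˢ? G f) ×-dec lookup X f ≟ c)
    regroup v f = trans (cong (_* 𝟙 (lookup X f ≟ c)) (𝟙-× (v ∈ˢ? G e) (v ∈ˢ? G f)))
      (trans (*-assoc (μ v e) _ _) (cong (μ v e *_) (sym (𝟙-× (v ∈ˢ? G f) (lookup X f ≟ c)))))
    disjoint : ∀ v {f g} → (v Data.Fin.Subset.∈ G f) × lookup X f ≡ c → (v Data.Fin.Subset.∈ G g) × lookup X g ≡ c → f ≡ g
    disjoint v {f} {g} (v∈f , Xf≡c) (v∈g , Xg≡c) with f ≟ g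
    ... | yes f≡g = f≡g
    ... | no  f≢g = contradiction (trans Xf≡c (sym Xg≡c)) (proper f g f≢g (v , v∈f , v∈g))

  -- If e and f meet then |e ∩ f| ≤ 1 + |e ∩ f| (|e ∩ f| − 1).
  ∑-common≤ : ∀ e f → ∑ V (λ v → common v e f) ≤ 𝟙 (share? G e f) + ∑ V (λ u → ∑ V (λ v → δ u v * (common u e f * common v e f)))
  ∑-common≤ e f with share? G e f
  ... | no ¬share = ≤-trans (∑-mono V λ {v} _ → 𝟙-no ((v ∈ˢ? G e) ×-dec (v ∈ˢ? G f)) (λ v∈ → ¬share (v , v∈)))
                      (≤-trans (≤-reflexive (∑.unit V)) z≤n)
  ... | yes (w , w∈) = begin
    ∑ V (λ v → common v e f)                                                        ≤⟨ ∑-mono V (λ {u} _ → split u) ⟩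
    ∑ V (λ u → 𝟙 (w ≟ u) + ∑ V (λ v → δ u v * (common u e f * common v e f)))       ≡⟨ ∑.merge V _ _ ⟩
    ∑ V (λ u → 𝟙 (w ≟ u)) + ∑ V (λ u → ∑ V (λ v → δ u v * (common u e f * common v e f)))  ≡⟨ cong (_+ ∑ V (λ u → ∑ V (λ v → δ u v * (common u e f * common v e f)))) (∑-𝟙-≟ w) ⟩
    1 + ∑ V (λ u → ∑ V (λ v → δ u v * (common u e f * common v e f)))               ∎
    where
    open ≤-Reasoning
    split : ∀ u → common u e f ≤ 𝟙 (w ≟ u) + ∑ V (λ v → δ u v * (common u e f * common v e f))
    split u with w ≟ u
    ... | yes refl = ≤-trans (𝟙≤1 ((u ∈ˢ? G e) ×-dec (u ∈ˢ? G f))) (m≤m+n 1 _)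
    ... | no  w≢u  = ≤-trans (≤-reflexive (sym at-w)) (term≤∑ (λ v → δ u v * (common u e f * common v e f)) (∈-allFinL w))
      where
      at-w : δ u w * (common u e f * common w e f) ≡ common u e f
      at-w = trans (cong₂ (λ x y → x * (common u e f * y)) (𝟙-yes (¬? (u ≟ w)) (λ { refl → w≢u refl })) (𝟙-yes ((w ∈ˢ? G e) ×-dec (w ∈ˢ? G f)) w∈))
               (trans (*-identityˡ _) (*-identityʳ _))

  ∑∑-common : ∀ {k D} → Uniform k G → Regular D G → ∀ e → ∑ Es (λ f → ∑ V (λ v → common v e f)) ≡ k * D
  ∑∑-common {k} {D} uniform regular e = begin
    ∑ Es (λ f → ∑ V (λ v → common v e f))          ≡⟨ ∑.exchange Es V _ ⟩
    ∑ V (λ v → ∑ Es (λ f → common v e f))          ≡⟨ ∑.congruence V (λ {v} _ → ∑.congruence Es λ {f} _ → 𝟙-× (v ∈ˢ? G e) (v ∈ˢ? G f)) ⟩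
    ∑ V (λ v → ∑ Es (λ f → μ v e * μ v f))         ≡⟨ ∑.congruence V (λ {v} _ → *-distribˡ-∑ (μ v e) Es (μ v)) ⟨
    ∑ V (λ v → μ v e * ∑ Es (μ v))                 ≡⟨ ∑.congruence V (λ {v} _ → cong (μ v e *_) (trans (sym (countTrue-∑ (λ f → does (v ∈ˢ? G f)))) (regular v))) ⟩
    ∑ V (λ v → μ v e * D)                          ≡⟨ *-distribʳ-∑ D V _ ⟨
    ∑ V (λ v → μ v e) * D                          ≡⟨ cong (_* D) (trans (sym (∣∣-∑ (G e))) (uniform e)) ⟩
    k * D                                          ∎
    where open ≡-Reasoning

  -- Summed over f first, each ordered pair of distinct vertices of `e` contributes its codegree, at
  -- most q/s. The factor `δ` removes the diagonal, where the codegree is a degree.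
  ∑-codegree≤ : ∀ {k s} → Uniform k G → (∀ u v → u ≢ v → codegree G u v * s ≤ q) → ∀ e →
    ∑ Es (λ f → ∑ V (λ u → ∑ V (λ v → δ u v * (common u e f * common v e f)))) * s ≤ k * k * q
  ∑-codegree≤ {k} {s} uniform codegree≤ e = begin
    ∑ Es (λ f → ∑ V (λ u → ∑ V (λ v → δ u v * (common u e f * common v e f)))) * s
      ≡⟨ cong (_* s) (∑.exchange Es V _) ⟩
    ∑ V (λ u → ∑ Es (λ f → ∑ V (λ v → δ u v * (common u e f * common v e f)))) * s
      ≡⟨ cong (_* s) (∑.congruence V λ _ → ∑.exchange Es V _) ⟩
    ∑ V (λ u → ∑ V (λ v → ∑ Es (λ f → δ u v * (common u e f * common v e f)))) * s
      ≡⟨ trans (*-distribʳ-∑ s V _) (∑.congruence V λ _ → *-distribʳ-∑ s V _) ⟩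
    ∑ V (λ u → ∑ V (λ v → ∑ Es (λ f → δ u v * (common u e f * common v e f)) * s))
      ≤⟨ ∑-mono V (λ {u} _ → ∑-mono V λ {v} _ → pair u v) ⟩
    ∑ V (λ u → ∑ V (λ v → μ u e * (μ v e * q)))
      ≡⟨ ∑.congruence V (λ {u} _ → trans (sym (*-distribˡ-∑ (μ u e) V _)) (cong (μ u e *_) (trans (sym (*-distribʳ-∑ q V _)) (cong (_* q) size)))) ⟩
    ∑ V (λ u → μ u e * (k * q))
      ≡⟨ trans (sym (*-distribʳ-∑ (k * q) V _)) (cong (_* (k * q)) size) ⟩
    k * (k * q)
      ≡⟨ *-assoc k k q ⟨
    k * k * q ∎
    where
    open ≤-Reasoning
    size : ∑ V (λ v → μ v e) ≡ k
    size = trans (sym (∣∣-∑ (G e))) (uniform e)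
    regroup : ∀ u v f → δ u v * (common u e f * common v e f) ≡ δ u v * (μ u e * μ v e) * 𝟙 ((u ∈ˢ? G f) ×-dec (v ∈ˢ? G f))
    regroup u v f rewrite 𝟙-× (u ∈ˢ? G e) (u ∈ˢ? G f) | 𝟙-× (v ∈ˢ? G e) (v ∈ˢ? G f) | 𝟙-× (u ∈ˢ? G f) (v ∈ˢ? G f) =
      identity (δ u v) (μ u e) (μ u f) (μ v e) (μ v f)
      where
      identity : ∀ d a b x y → d * ((a * b) * (x * y)) ≡ d * (a * x) * (b * y)
      identity = solve-∀
    pair : ∀ u v → ∑ Es (λ f → δ u v * (common u e f * common v e f)) * s ≤ μ u e * (μ v e * q)
    pair u v = begin
      ∑ Es (λ f → δ u v * (common u e f * common v e f)) * s
        ≡⟨ cong (_* s) (trans (∑.congruence Es λ {f} _ → regroup u v f) (sym (*-distribˡ-∑ (δ u v * (μ u e * μ v e)) Es _))) ⟩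
      δ u v * (μ u e * μ v e) * ∑ Es (λ f → 𝟙 ((u ∈ˢ? G f) ×-dec (v ∈ˢ? G f))) * s
        ≡⟨ cong (λ z → δ u v * (μ u e * μ v e) * z * s) (countTrue-∑ (λ f → does ((u ∈ˢ? G f) ×-dec (v ∈ˢ? G f)))) ⟨
      δ u v * (μ u e * μ v e) * codegree G u v * s
        ≤⟨ distinct (u ≟ v) ⟩
      μ u e * (μ v e * q) ∎
      where
      distinct : (d : Dec (u ≡ v)) → 𝟙 (¬? d) * (μ u e * μ v e) * codegree G u v * s ≤ μ u e * (μ v e * q)
      distinct (yes _)  = z≤n
      distinct (no u≢v) = begin
        1 * (μ u e * μ v e) * codegree G u v * s    ≡⟨ identity (μ u e) (μ v e) (codegree G u v) s ⟩
        μ u e * (μ v e * (codegree G u v * s))      ≤⟨ *-monoʳ-≤ (μ u e) (*-monoʳ-≤ (μ v e) (codegree≤ u v u≢v)) ⟩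
        μ u e * (μ v e * q)                         ∎
        where
        identity : ∀ a b x y → 1 * (a * b) * x * y ≡ a * (b * (x * y))
        identity = solve-∀

  deficient : ℕ → Fin E → Vec (Fin q) E → ℕ
  deficient k e X = ∑ (allFinL q) (λ c → 𝟙 (multiplicity e X c <? k))

  -- No colour occurs more than k times, and a deficient one at most k - 1 times, so each deficient
  -- colour can be counted once more within the budget of k per colour.
  deficient+neighbours≤ : ∀ {k} → Uniform k G → ∀ e X → Proper G X → deficient k e X + neighbours e ≤ k * q
  deficient+neighbours≤ {k} uniform e X proper = begin
    deficient k e X + neighbours e                                                         ≡⟨ cong (deficient k e X +_) (∑-multiplicity e X) ⟨
    deficient k e X + ∑ (allFinL q) (multiplicity e X)                                     ≡⟨ ∑.merge (allFinL q) _ _ ⟨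
    ∑ (allFinL q) (λ c → 𝟙 (multiplicity e X c <? k) + multiplicity e X c)                 ≤⟨ ∑-mono (allFinL q) (λ {c} _ → pointwise c (multiplicity e X c <? k)) ⟩
    ∑ (allFinL q) (λ _ → k)                                                                ≡⟨ trans (∑-const (allFinL q) k) (cong (_* k) (length-allFinL q)) ⟩
    q * k                                                                                  ≡⟨ *-comm q k ⟩
    k * q                                                                                  ∎
    where
    open ≤-Reasoning
    pointwise : ∀ c (d : Dec (multiplicity e X c < k)) → 𝟙 d + multiplicity e X c ≤ k
    pointwise c (yes m<k) = m<k
    pointwise c (no _)    = ≤-trans (multiplicity≤size e X proper c) (≤-reflexive (uniform e))

  -- By inclusion-exclusion there are at least kD neighbours, up to the pairs counted by codegrees,
  -- while `deficient+neighbours≤` leaves room for at most kq. The excess k(q - D) is at most kD/s,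
  -- and the pairs number at most k²q/s. Adding `k * D * s` to both sides avoids subtraction.
  deficient-bound : ∀ {k D s} → Uniform k G → Regular D G → q * s ≤ D * (s + 1) →
    (∀ u v → u ≢ v → codegree G u v * s ≤ q) → ∀ e X → Proper G X →
    deficient k e X * s ≤ k * D + k * k * q
  deficient-bound {k} {D} {s} uniform regular q≤ codegree≤ e X proper = +-cancelʳ-≤ (k * D * s) _ _ (begin
    d * s + k * D * s                       ≡⟨ cong (λ z → d * s + z * s) (∑∑-common uniform regular e) ⟨
    d * s + ∑ Es (λ f → ∑ V (λ v → common v e f)) * s   ≤⟨ +-monoʳ-≤ (d * s) (*-monoˡ-≤ s (∑-mono Es λ {f} _ → ∑-common≤ e f)) ⟩
    d * s + ∑ Es (λ f → 𝟙 (share? G e f) + pairs f) * s ≡⟨ cong (λ z → d * s + z * s) (∑.merge Es _ pairs) ⟩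
    d * s + (neighbours e + ∑ Es pairs) * s ≡⟨ distribute d (neighbours e) (∑ Es pairs) s ⟩
    (d + neighbours e) * s + ∑ Es pairs * s ≤⟨ +-mono-≤ (*-monoˡ-≤ s (deficient+neighbours≤ uniform e X proper)) (∑-codegree≤ uniform codegree≤ e) ⟩
    k * q * s + k * k * q                   ≡⟨ cong (_+ k * k * q) (*-assoc k q s) ⟩
    k * (q * s) + k * k * q                 ≤⟨ +-monoˡ-≤ (k * k * q) (*-monoʳ-≤ k q≤) ⟩
    k * (D * (s + 1)) + k * k * q           ≡⟨ expand k D s (k * k * q) ⟩
    (k * D + k * k * q) + k * D * s         ∎)
    where
    open ≤-Reasoning
    d = deficient k e X
    pairs : Fin E → ℕ
    pairs f = ∑ V (λ u → ∑ V (λ v → δ u v * (common u e f * common v e f)))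
    distribute : ∀ d r p s → d * s + (r + p) * s ≡ (d + r) * s + p * s
    distribute = solve-∀
    expand : ∀ k D s z → k * (D * (s + 1)) + z ≡ (k * D + z) + k * D * s
    expand = solve-∀

-- Averaging over random levels

𝟙-∏ : (d : Dec P) {R : A → Set} (R? : ∀ x → Dec (R x)) (xs : List A) → (P → ∀ x → R x) → 𝟙 d ≤ ∏ xs (λ x → 𝟙 (R? x))
𝟙-∏ (no _)  R? xs P⇒R = z≤n
𝟙-∏ (yes p) R? xs P⇒R = ≤-reflexive (sym (trans (∏.congruence xs λ {x} _ → 𝟙-yes (R? x) (P⇒R p x)) (∏.unit xs)))

∑-above : ∀ L (j : Fin L) → ∑ (allFinL L) (λ a → 𝟙 (toℕ j ≤? toℕ a)) ≡ L ∸ toℕ j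
∑-above (suc L) Fin.zero = begin
  1 + ∑ (map Fin.suc (allFinL L)) (λ a → 1)   ≡⟨ cong suc (∑.big-map Fin.suc (allFinL L) _) ⟩
  1 + ∑ (allFinL L) (λ a → 1)                 ≡⟨ cong suc (length-∑ (allFinL L)) ⟨
  1 + length (allFinL L)                      ≡⟨ cong suc (length-allFinL L) ⟩
  suc L                                       ∎
  where open ≡-Reasoning
∑-above (suc L) (Fin.suc j) = begin
  ∑ (map Fin.suc (allFinL L)) (λ a → 𝟙 (suc (toℕ j) ≤? toℕ a))   ≡⟨ ∑.big-map Fin.suc (allFinL L) _ ⟩
  ∑ (allFinL L) (λ a → 𝟙 (suc (toℕ j) ≤? suc (toℕ a)))           ≡⟨ ∑.congruence (allFinL L) (λ {a} _ → ≤-antisym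
                                                                      (𝟙-mono (suc (toℕ j) ≤? suc (toℕ a)) (toℕ j ≤? toℕ a) (λ { (s≤s p) → p }))
                                                                      (𝟙-mono (toℕ j ≤? toℕ a) (suc (toℕ j) ≤? suc (toℕ a)) s≤s)) ⟩
  ∑ (allFinL L) (λ a → 𝟙 (toℕ j ≤? toℕ a))                       ≡⟨ ∑-above L j ⟩
  L ∸ toℕ j                                                      ∎
  where open ≡-Reasoning

suc∣! : ∀ {m n} → m < n → suc m ∣ n !
suc∣! {m} {suc n} (s≤s m≤n) with m≤n⇒m<n∨m≡n m≤n
... | inj₂ refl = m∣m*n (m !)
... | inj₁ m<n  = ∣-trans (suc∣! m<n) (divides (suc n) refl)

complement : ∀ {L} → Fin L → ℕ
complement {L} j = L ∸ toℕ j

complement≢0 : ∀ {L} (j : Fin L) → NonZero (complement j)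
complement≢0 j = >-nonZero (m<n⇒0<n∸m (toℕ<n j))

-- Makes the weights (L!/(L - j))^k natural numbers, with (L!)^k as the common value `W`.
complement∣! : ∀ {L} (j : Fin L) → complement j ∣ L !
complement∣! {suc L} j = subst (_∣ suc L !) (sym (+-∸-assoc 1 (≤-pred (toℕ<n j)))) (suc∣! (s≤s (m∸n≤m L (toℕ j))))

levels : ∀ {L E} → Vec (Fin L) E → Fin E → ℕ
levels α e = toℕ (lookup α e)

module _ {n E q k : ℕ} (G : Hypergraph n E) (k≥2 : k ≥ 2) (L : ℕ) .{{_ : NonZero L}}
         (e : Fin E) (X : Vec (Fin q) E) (proper : Proper G X) where

  private
    Es = allFinL E
    Js = allFinL L
    Ω  = allVecs L E

    Blocks : Fin q → Fin E → Set
    Blocks c f = Share G e f × lookup X f ≡ c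

    blocks? : ∀ c f → Dec (Blocks c f)
    blocks? c f = share? G e f ×-dec lookup X f ≟ c

  -- By properness only `e` itself can be a neighbour with its colour, so the multiplicity is at
  -- most 1, which is below k.
  own-colour-deficient : multiplicity G e X (lookup X e) < k
  own-colour-deficient = ≤-trans (s≤s (∑-𝟙-subsingleton (blocks? (lookup X e)) λ b b′ → trans (sym (only b)) (only b′))) k≥2
    where
    only : ∀ {f} → Blocks (lookup X e) f → e ≡ f
    only {f} (e~f , Xf≡Xe) with e ≟ f
    ... | yes e≡f = e≡f
    ... | no  e≢f = contradiction (sym Xf≡Xe) (proper e f e≢f e~f)

  module _ (c : Fin q) (full : multiplicity G e X c ≡ k) where

    -- Required of every f, this says that e has level j and that no edge of smaller level excludes
    -- `c`. Each condition reads a single coordinate of the level vector, so `∑-∏-allVecs` applies.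
    Fits : Fin L → Fin E → Fin L → Set
    Fits j f a = (e ≡ f → j ≡ a) × (Blocks c f → toℕ j ≤ toℕ a)

    fits? : ∀ j f a → Dec (Fits j f a)
    fits? j f a = (e ≟ f →-dec j ≟ a) ×-dec (blocks? c f →-dec toℕ j ≤? toℕ a)

    -- There are L levels to choose from, cut down to one for `e` and to L - j for a blocking edge.
    -- Indicator exponents give all cases one shape, so that the product over f merely adds
    -- exponents.
    count-fits : ∀ j f → ∑ Js (λ a → 𝟙 (fits? j f a)) * (L ^ 𝟙 (e ≟ f) * L ^ 𝟙 (blocks? c f)) ≤ L * complement j ^ 𝟙 (blocks? c f)
    count-fits j f = cases (e ≟ f) (blocks? c f)
      where
      open ≤-Reasoning
      fits = ∑ Js (λ a → 𝟙 (fits? j f a))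
      cases : (d : Dec (e ≡ f)) (d′ : Dec (Blocks c f)) → fits * (L ^ 𝟙 d * L ^ 𝟙 d′) ≤ L * complement j ^ 𝟙 d′
      -- The colour of `e` is deficient, so a full colour is never blocked by `e` itself.
      cases (yes refl) (yes (_ , refl)) = contradiction full (<⇒≢ own-colour-deficient)
      cases (yes e≡f)  (no _)  = begin
        fits * (L * 1 * 1)    ≤⟨ *-monoˡ-≤ _ (∑-mono Js λ {a} _ → 𝟙-mono (fits? j f a) (j ≟ a) λ h → proj₁ h e≡f) ⟩
        ∑ Js (λ a → 𝟙 (j ≟ a)) * (L * 1 * 1)  ≡⟨ cong (_* (L * 1 * 1)) (∑-𝟙-≟ j) ⟩
        1 * (L * 1 * 1)       ≡⟨ identity L ⟩
        L * 1                 ∎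
        where
        identity : ∀ L → 1 * (L * 1 * 1) ≡ L * 1
        identity = solve-∀
      cases (no _)     (yes b) = begin
        fits * (1 * (L * 1))  ≤⟨ *-monoˡ-≤ _ (∑-mono Js λ {a} _ → 𝟙-mono (fits? j f a) (toℕ j ≤? toℕ a) λ h → proj₂ h b) ⟩
        ∑ Js (λ a → 𝟙 (toℕ j ≤? toℕ a)) * (1 * (L * 1))  ≡⟨ cong (_* (1 * (L * 1))) (∑-above L j) ⟩
        complement j * (1 * (L * 1))  ≡⟨ identity (complement j) L ⟩
        L * (complement j * 1)        ∎
        where
        identity : ∀ x L → x * (1 * (L * 1)) ≡ L * (x * 1)
        identity = solve-∀
      cases (no _)     (no _)  = begin
        fits * 1              ≤⟨ *-monoˡ-≤ 1 (∑-mono Js λ {a} _ → 𝟙≤1 (fits? j f a)) ⟩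
        ∑ Js (λ a → 1) * 1    ≡⟨ cong (_* 1) (trans (sym (length-∑ Js)) (length-allFinL L)) ⟩
        L * 1                 ∎

    count-levels : ∀ j → ∏ Es (λ f → ∑ Js (λ a → 𝟙 (fits? j f a))) * (L * L ^ k) ≤ L ^ E * complement j ^ k
    count-levels j = subst₂ _≤_
      (trans (∏.merge Es _ _) (cong (∏ Es (λ f → ∑ Js (λ a → 𝟙 (fits? j f a))) *_)
        (trans (∏.merge Es _ _) (cong₂ _*_
          (trans (∏-^-∑ Es L _) (trans (cong (L ^_) (∑-𝟙-≟ e)) (*-identityʳ L)))
          (trans (∏-^-∑ Es L _) (cong (L ^_) full))))))
      (trans (∏.merge Es _ _) (cong₂ _*_
        (trans (∏-const Es L) (cong (L ^_) (length-allFinL E)))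
        (trans (∏-^-∑ Es (complement j) _) (cong (complement j ^_) full))))
      (∏-mono Es λ {f} _ → count-fits j f)

    -- Level j for e together with availability of `c` has probability at most ((L - j)/L)^k / L;
    -- the weight cancels the dependence on j, so all L levels contribute equally.
    full-average : ∀ {w : Fin L → ℕ} {W} → (∀ j → w j * complement j ^ k ≡ W) →
      ∑ Ω (λ α → w (lookup α e) * 𝟙 (available? G (levels α) e X c)) * L ^ k ≤ L ^ E * W
    full-average {w} {W} w*≡W = *-cancelˡ-≤ L (begin
      L * (∑ Ω (λ α → w (lookup α e) * av α) * L ^ k)
        ≤⟨ *-monoʳ-≤ L (*-monoˡ-≤ (L ^ k) (∑-mono Ω λ {α} _ → split α)) ⟩
      L * (∑ Ω (λ α → ∑ Js (λ j → w j * ∏ Es (λ f → 𝟙 (fits? j f (lookup α f))))) * L ^ k)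
        ≡⟨ cong (λ z → L * (z * L ^ k)) (∑.exchange Ω Js _) ⟩
      L * (∑ Js (λ j → ∑ Ω (λ α → w j * ∏ Es (λ f → 𝟙 (fits? j f (lookup α f))))) * L ^ k)
        ≡⟨ cong (λ z → L * (z * L ^ k)) (∑.congruence Js λ {j} _ →
             trans (sym (*-distribˡ-∑ (w j) Ω _)) (cong (w j *_) (∑-∏-allVecs L E λ f a → 𝟙 (fits? j f a)))) ⟩
      L * (∑ Js (λ j → w j * p j) * L ^ k)
        ≡⟨ rotate L (∑ Js (λ j → w j * p j)) (L ^ k) ⟩
      ∑ Js (λ j → w j * p j) * (L * L ^ k)
        ≡⟨ *-distribʳ-∑ (L * L ^ k) Js _ ⟩
      ∑ Js (λ j → w j * p j * (L * L ^ k))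
        ≤⟨ ∑-mono Js (λ {j} _ → term j) ⟩
      ∑ Js (λ _ → L ^ E * W)
        ≡⟨ trans (∑-const Js _) (cong (_* (L ^ E * W)) (length-allFinL L)) ⟩
      L * (L ^ E * W) ∎)
      where
      open ≤-Reasoning
      av : Vec (Fin L) E → ℕ
      av α = 𝟙 (available? G (levels α) e X c)
      p : Fin L → ℕ
      p j = ∏ Es (λ f → ∑ Js (λ a → 𝟙 (fits? j f a)))
      rotate : ∀ a b c → a * (b * c) ≡ b * (a * c)
      rotate = solve-∀
      split : ∀ α → w (lookup α e) * av α ≤ ∑ Js (λ j → w j * ∏ Es (λ f → 𝟙 (fits? j f (lookup α f))))
      split α = ≤-trans
        (*-monoʳ-≤ (w (lookup α e)) (𝟙-∏ (available? G (levels α) e X c) (λ f → fits? (lookup α e) f (lookup α f)) Es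
          λ free f → (λ { refl → refl }) , λ (e~f , Xf≡c) → free f e~f Xf≡c))
        (term≤∑ (λ j → w j * ∏ Es (λ f → 𝟙 (fits? j f (lookup α f)))) (∈-allFinL (lookup α e)))
      term : ∀ j → w j * p j * (L * L ^ k) ≤ L ^ E * W
      term j = begin
        w j * p j * (L * L ^ k)             ≡⟨ *-assoc (w j) _ _ ⟩
        w j * (p j * (L * L ^ k))           ≤⟨ *-monoʳ-≤ (w j) (count-levels j) ⟩
        w j * (L ^ E * complement j ^ k)    ≡⟨ rotate (w j) (L ^ E) _ ⟩
        L ^ E * (w j * complement j ^ k)    ≡⟨ cong (L ^ E *_) (w*≡W j) ⟩
        L ^ E * W                           ∎

  module _ (uniform : Uniform k G) {w : Fin L → ℕ} {W : ℕ} (w*≡W : ∀ j → w j * complement j ^ k ≡ W) where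

    colour-average : ∀ c → ∑ Ω (λ α → w (lookup α e) * 𝟙 (available? G (levels α) e X c)) * L ^ k
                           ≤ L ^ E * W * (1 + 𝟙 (multiplicity G e X c <? k) * L ^ k)
    colour-average c = cases (multiplicity G e X c <? k)
      where
      open ≤-Reasoning
      total = ∑ Ω (λ α → w (lookup α e) * 𝟙 (available? G (levels α) e X c))
      w≤W : ∀ j → w j ≤ W
      w≤W j = subst (w j ≤_) (w*≡W j) (m≤m*n (w j) (complement j ^ k) {{m^n≢0 (complement j) k {{complement≢0 j}}}})
      cases : (d : Dec (multiplicity G e X c < k)) → total * L ^ k ≤ L ^ E * W * (1 + 𝟙 d * L ^ k)
      cases (no ≮k)  = ≤-trans (full-average c (≤-antisym (≤-trans (multiplicity≤size G e X proper c) (≤-reflexive (uniform e))) (≮⇒≥ ≮k)) {w} w*≡W)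
                               (≤-reflexive (sym (*-identityʳ _)))
      cases (yes _) = begin
        total * L ^ k                ≤⟨ *-monoˡ-≤ (L ^ k) (∑-mono Ω λ {α} _ → *-mono-≤ (w≤W (lookup α e)) (𝟙≤1 (available? G (levels α) e X c))) ⟩
        ∑ Ω (λ α → W * 1) * L ^ k    ≡⟨ cong (_* L ^ k) (trans (∑-const Ω _) (cong₂ _*_ (length-allVecs L E) (*-identityʳ W))) ⟩
        L ^ E * W * L ^ k            ≤⟨ *-monoʳ-≤ (L ^ E * W) (≤-trans (≤-reflexive (sym (*-identityˡ (L ^ k)))) (n≤1+n _)) ⟩
        L ^ E * W * (1 + 1 * L ^ k)  ∎

    available-average : ∑ Ω (λ α → w (lookup α e) * available G (levels α) e X) * L ^ k
                        ≤ L ^ E * W * (q + deficient G k e X * L ^ k)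
    available-average = begin
      ∑ Ω (λ α → w (lookup α e) * available G (levels α) e X) * L ^ k
        ≡⟨ cong (_* L ^ k) (trans (∑.congruence Ω λ {α} _ → *-distribˡ-∑ (w (lookup α e)) (allFinL q) _) (∑.exchange Ω (allFinL q) _)) ⟩
      ∑ (allFinL q) (λ c → ∑ Ω (λ α → w (lookup α e) * 𝟙 (available? G (levels α) e X c))) * L ^ k
        ≡⟨ *-distribʳ-∑ (L ^ k) (allFinL q) _ ⟩
      ∑ (allFinL q) (λ c → ∑ Ω (λ α → w (lookup α e) * 𝟙 (available? G (levels α) e X c)) * L ^ k)
        ≤⟨ ∑-mono (allFinL q) (λ {c} _ → colour-average c) ⟩
      ∑ (allFinL q) (λ c → L ^ E * W * (1 + 𝟙 (multiplicity G e X c <? k) * L ^ k))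
        ≡⟨ *-distribˡ-∑ (L ^ E * W) (allFinL q) _ ⟨
      L ^ E * W * ∑ (allFinL q) (λ c → 1 + 𝟙 (multiplicity G e X c <? k) * L ^ k)
        ≡⟨ cong (L ^ E * W *_) (trans (∑.merge (allFinL q) _ _) (cong₂ _+_
             (trans (sym (length-∑ (allFinL q))) (length-allFinL q)) (sym (*-distribʳ-∑ (L ^ k) (allFinL q) _)))) ⟩
      L ^ E * W * (q + deficient G k e X * L ^ k) ∎
      where open ≤-Reasoning

    -- AM-GM is applied to the weighted availabilities. Writing each factor `W` as
    -- `w j * complement j ^ k` for the level j of e lets the weights cancel and leaves the product
    -- of the complements.
    available-geometric : (∀ j → NonZero (w j)) →
      ∏ Ω (λ α → available G (levels α) e X) * (L ^ k) ^ (L ^ E)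
      ≤ (q + deficient G k e X * L ^ k) ^ (L ^ E) * ∏ Ω (λ α → complement (lookup α e)) ^ k
    available-geometric w≢0 = *-cancelˡ-≤ (N ^ N * Πw) {{m*n≢0 _ _ {{n^n≢0 N}} {{∏-nonZero Ω λ α → w≢0 (lookup α e)}}}} (begin
      N ^ N * Πw * (Πa * (L ^ k) ^ N)          ≡⟨ shuffle (N ^ N) Πw Πa ((L ^ k) ^ N) ⟩
      N ^ N * (Πw * Πa) * (L ^ k) ^ N          ≡⟨ cong (λ z → N ^ N * z * (L ^ k) ^ N) (∏.merge Ω _ _) ⟨
      N ^ N * ∏ Ω wa * (L ^ k) ^ N             ≤⟨ *-monoˡ-≤ _ (subst (λ z → z ^ z * ∏ Ω wa ≤ ∑ Ω wa ^ z) (length-allVecs L E) (am-gm-∑ Ω wa)) ⟩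
      ∑ Ω wa ^ N * (L ^ k) ^ N                 ≡⟨ ^-distribʳ-* (∑ Ω wa) (L ^ k) N ⟨
      (∑ Ω wa * L ^ k) ^ N                     ≤⟨ ^-monoˡ-≤ N available-average ⟩
      (N * W * Q′) ^ N                         ≡⟨ trans (^-distribʳ-* (N * W) Q′ N) (cong (_* Q′ ^ N) (^-distribʳ-* N W N)) ⟩
      N ^ N * W ^ N * Q′ ^ N                   ≡⟨ cong (λ z → N ^ N * z * Q′ ^ N) W^N ⟩
      N ^ N * (Πw * Πc ^ k) * Q′ ^ N           ≡⟨ shuffle′ (N ^ N) Πw (Πc ^ k) (Q′ ^ N) ⟩
      N ^ N * Πw * (Q′ ^ N * Πc ^ k)           ∎)
      where
      open ≤-Reasoning
      N = L ^ E
      Q′ = q + deficient G k e X * L ^ k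
      wa : Vec (Fin L) E → ℕ
      wa α = w (lookup α e) * available G (levels α) e X
      Πw = ∏ Ω (λ α → w (lookup α e))
      Πa = ∏ Ω (λ α → available G (levels α) e X)
      Πc = ∏ Ω (λ α → complement (lookup α e))
      W^N : W ^ N ≡ Πw * Πc ^ k
      W^N = trans (cong (W ^_) (sym (length-allVecs L E))) (trans (sym (∏-const Ω W))
        (trans (∏.congruence Ω λ {α} _ → sym (w*≡W (lookup α e))) (trans (∏.merge Ω _ _) (cong (Πw *_) (∏-^ Ω _ k)))))
      shuffle : ∀ a b c d → a * b * (c * d) ≡ a * (b * c) * d
      shuffle = solve-∀
      shuffle′ : ∀ a b c d → a * (b * c) * d ≡ a * b * (d * c)
      shuffle′ = solve-∀

  -- `R / r` is a rational upper bound for the bracket. The power `L` lets `∏-lookup` turn the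
  -- product of the complements into a power of L!.
  availability-bound : Uniform k G → ∀ {r R} → r * (q + deficient G k e X * L ^ k) ≤ R →
    ∏ Ω (λ α → available G (levels α) e X) ^ L * ((r * L ^ k) ^ L) ^ (L ^ E) ≤ (R ^ L * (L !) ^ k) ^ (L ^ E)
  availability-bound uniform {r} {R} rQ≤R = begin
    Πa ^ L * ((r * L ^ k) ^ L) ^ N                ≡⟨ cong (Πa ^ L *_) (^-swap (r * L ^ k) L N) ⟩
    Πa ^ L * ((r * L ^ k) ^ N) ^ L                ≡⟨ ^-distribʳ-* Πa _ L ⟨
    (Πa * (r * L ^ k) ^ N) ^ L                    ≡⟨ cong (_^ L) (trans (cong (Πa *_) (^-distribʳ-* r (L ^ k) N)) (rotate Πa (r ^ N) _)) ⟩
    (r ^ N * (Πa * (L ^ k) ^ N)) ^ L              ≤⟨ ^-monoˡ-≤ L (*-monoʳ-≤ (r ^ N) (available-geometric uniform w*≡W w≢0)) ⟩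
    (r ^ N * (Q′ ^ N * Πc ^ k)) ^ L               ≡⟨ cong (_^ L) (trans (sym (*-assoc (r ^ N) _ _)) (cong (_* Πc ^ k) (sym (^-distribʳ-* r Q′ N)))) ⟩
    ((r * Q′) ^ N * Πc ^ k) ^ L                   ≤⟨ ^-monoˡ-≤ L (*-monoˡ-≤ (Πc ^ k) (^-monoˡ-≤ N rQ≤R)) ⟩
    (R ^ N * Πc ^ k) ^ L                          ≡⟨ ^-distribʳ-* (R ^ N) (Πc ^ k) L ⟩
    (R ^ N) ^ L * (Πc ^ k) ^ L                    ≡⟨ cong₂ _*_ (^-swap R N L) (trans (^-swap Πc k L) (trans (cong (_^ k) Πc^L) (^-swap (L !) N k))) ⟩
    (R ^ L) ^ N * ((L !) ^ k) ^ N                 ≡⟨ ^-distribʳ-* (R ^ L) _ N ⟨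
    (R ^ L * (L !) ^ k) ^ N                       ∎
    where
    open ≤-Reasoning
    N = L ^ E
    Q′ = q + deficient G k e X * L ^ k
    Πa = ∏ Ω (λ α → available G (levels α) e X)
    Πc = ∏ Ω (λ α → complement (lookup α e))
    Πc^L : Πc ^ L ≡ (L !) ^ N
    Πc^L = trans (∏-lookup L complement e) (cong (_^ N) (∏-falling L))
    rotate : ∀ a b c → a * (b * c) ≡ b * (a * c)
    rotate = solve-∀
    w : Fin L → ℕ
    w j = _∣_.quotient (complement∣! j) ^ k
    w*≡W : ∀ j → w j * complement j ^ k ≡ (L !) ^ k
    w*≡W j = trans (sym (^-distribʳ-* (_∣_.quotient (complement∣! j)) (complement j) k)) (cong (_^ k) (sym (_∣_.equality (complement∣! j))))
    w≢0 : ∀ j → NonZero (w j)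
    w≢0 j = m*n≢0⇒m≢0 (w j) {{subst NonZero (sym (w*≡W j)) (m^n≢0 (L !) k {{L !≢0}})}}

-- Combining all edges and choosing the parameters

colourings-bound : ∀ {n E q k} (G : Hypergraph n E) → k ≥ 2 → Uniform k G → ∀ L .{{_ : NonZero L}} {r R} →
  (∀ e X → Proper G X → r * (q + deficient G k e X * L ^ k) ≤ R) →
  numProperColorings G q ^ L * ((r * L ^ k) ^ L) ^ E ≤ (R ^ L * (L !) ^ k) ^ E
colourings-bound {n} {E} {q} {k} G k≥2 uniform L {r} {R} rQ≤R = root M refl
  where
  open ≤-Reasoning
  S = properColourings G q
  M = length S
  Es = allFinL E
  Ω = allVecs L E
  N = L ^ E
  x = (r * L ^ k) ^ L
  y = R ^ L * (L !) ^ k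
  N≢0 : NonZero N
  N≢0 = m^n≢0 L E
  a : Fin E → Vec (Fin q) E → ℕ
  a e X = ∏ Ω (λ α → available G (levels α) e X)
  ∏ES : ∀ z → ∏ S (λ _ → ∏ Es (λ _ → z ^ N)) ≡ ((z ^ E) ^ N) ^ M
  ∏ES z = trans (∏-const S _) (cong (_^ M) (trans (∏-const Es _) (trans (cong ((z ^ N) ^_) (length-allFinL E)) (^-swap z N E))))
  -- `entropy-bound` is multiplied over all N level vectors; exchanging the products isolates one
  -- edge and one colouring, where `availability-bound` applies.
  powers : ((M ^ L * x ^ E) ^ N) ^ M ≤ ((y ^ E) ^ N) ^ M
  powers = begin
    ((M ^ L * x ^ E) ^ N) ^ M                 ≡⟨ trans (cong (_^ M) (^-distribʳ-* (M ^ L) (x ^ E) N)) (^-distribʳ-* ((M ^ L) ^ N) _ M) ⟩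
    ((M ^ L) ^ N) ^ M * ((x ^ E) ^ N) ^ M     ≡⟨ cong₂ _*_ reorder (sym (∏ES x)) ⟩
    ((M ^ M) ^ N) ^ L * ∏ S (λ _ → ∏ Es (λ _ → x ^ N))
      ≤⟨ *-monoˡ-≤ _ (^-monoˡ-≤ L (subst (_≤ ∏ Ω (λ α → ∏ S (λ X → ∏ Es (λ e → available G (levels α) e X))))
           (trans (∏-const Ω _) (cong ((M ^ M) ^_) (length-allVecs L E)))
           (∏-mono Ω λ {α} _ → entropy-bound G (levels α)))) ⟩
    ∏ Ω (λ α → ∏ S (λ X → ∏ Es (λ e → available G (levels α) e X))) ^ L * ∏ S (λ _ → ∏ Es (λ _ → x ^ N))
      ≡⟨ cong (λ z → z ^ L * ∏ S (λ _ → ∏ Es (λ _ → x ^ N))) (trans (∏.exchange Ω S _) (∏.congruence S λ _ → ∏.exchange Ω Es _)) ⟩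
    ∏ S (λ X → ∏ Es (λ e → a e X)) ^ L * ∏ S (λ _ → ∏ Es (λ _ → x ^ N))
      ≡⟨ cong (_* ∏ S (λ _ → ∏ Es (λ _ → x ^ N))) (trans (sym (∏-^ S _ L)) (∏.congruence S λ _ → sym (∏-^ Es _ L))) ⟩
    ∏ S (λ X → ∏ Es (λ e → a e X ^ L)) * ∏ S (λ _ → ∏ Es (λ _ → x ^ N))
      ≡⟨ trans (sym (∏.merge S _ _)) (∏.congruence S λ _ → sym (∏.merge Es _ _)) ⟩
    ∏ S (λ X → ∏ Es (λ e → a e X ^ L * x ^ N))
      ≤⟨ ∏-mono S (λ {X} X∈S → ∏-mono Es λ {e} _ → let proper = proj₂ (∈-filter⁻ (proper? G) {xs = allVecs q E} X∈S) in
           availability-bound G k≥2 L e X proper uniform {r} {R} (rQ≤R e X proper)) ⟩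
    ∏ S (λ X → ∏ Es (λ e → y ^ N))           ≡⟨ ∏ES y ⟩
    ((y ^ E) ^ N) ^ M                         ∎
    where
    reorder : ((M ^ L) ^ N) ^ M ≡ ((M ^ M) ^ N) ^ L
    reorder = trans (^-swap (M ^ L) N M) (trans (cong (_^ N) (^-swap M L M)) (^-swap (M ^ M) L N))
  root : ∀ m → M ≡ m → M ^ L * x ^ E ≤ y ^ E
  -- The exponent M can only be cancelled if it is positive; for M = 0 the left-hand side vanishes.
  root zero      M≡0 = ≤-trans (≤-reflexive (cong (_* x ^ E) (trans (cong (_^ L) M≡0) (0^n≡0 L)))) z≤n
    where
    0^n≡0 : ∀ n .{{_ : NonZero n}} → 0 ^ n ≡ 0
    0^n≡0 (suc n) = refl
  root (suc m) M≡s = ^-cancelˡ-≤ N {{N≢0}} (^-cancelˡ-≤ M {{subst NonZero (sym M≡s) _}} powers)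

-- `factorial-bound` gives the factor b/a to the power L − m only; the missing factor (a/b)^m is absorbed
-- by ((2t + 1)/2t)^L ≥ 1 + L/2t, whence the choice of L.
euler-absorb : ∀ t .{{_ : NonZero t}} k m .{{_ : NonZero m}} q →
  let a = suc m ^ (m * k); b = m ^ (m * k); L = m + 2 * t * a ^ m in
  ((t + 1) * 2 * q) ^ L * (L !) ^ k * (t * a) ^ L ≤ (suc (2 * t) * L ^ k) ^ L * ((t + 1) * q * b) ^ L
euler-absorb t k m q = begin
  ((t + 1) * 2 * q) ^ L * F * (t * a) ^ L
    ≡⟨ cong (λ z → ((t + 1) * 2 * q) ^ L * F * z) (trans (^-distribʳ-* t a L) (cong (t ^ L *_) (^-distribˡ-+-* a m d))) ⟩
  ((t + 1) * 2 * q) ^ L * F * (t ^ L * (a ^ m * a ^ d))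
    ≡⟨ shuffle (((t + 1) * 2 * q) ^ L) F (t ^ L) (a ^ m) (a ^ d) ⟩
  (((t + 1) * 2 * q) ^ L * t ^ L) * a ^ m * (F * a ^ d)
    ≡⟨ cong (λ z → z * a ^ m * (F * a ^ d)) regroup ⟩
  (p ^ L * (2 * t) ^ L) * a ^ m * (F * a ^ d)
    ≡⟨ cong (_* (F * a ^ d)) (*-assoc (p ^ L) _ _) ⟩
  p ^ L * ((2 * t) ^ L * a ^ m) * (F * a ^ d)
    ≤⟨ *-mono-≤ (*-monoʳ-≤ (p ^ L) absorb) factorial ⟩
  p ^ L * (r ^ L * b ^ m) * ((L ^ k) ^ L * b ^ d)
    ≡⟨ shuffle′ (p ^ L) (r ^ L) (b ^ m) ((L ^ k) ^ L) (b ^ d) ⟩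
  r ^ L * (L ^ k) ^ L * (p ^ L * (b ^ m * b ^ d))
    ≡⟨ cong₂ _*_ (^-distribʳ-* r (L ^ k) L) (trans (^-distribʳ-* p b L) (cong (p ^ L *_) (^-distribˡ-+-* b m d))) ⟨
  (r * L ^ k) ^ L * (p * b) ^ L ∎
  where
  open ≤-Reasoning
  a = suc m ^ (m * k)
  b = m ^ (m * k)
  d = 2 * t * a ^ m
  L = m + d
  F = (L !) ^ k
  r = suc (2 * t)
  p = (t + 1) * q
  2t≢0 : NonZero (2 * t)
  2t≢0 = m*n≢0 2 t
  shuffle : ∀ p F t u v → p * F * (t * (u * v)) ≡ (p * t) * u * (F * v)
  shuffle = solve-∀
  shuffle′ : ∀ p r u l v → p * (r * u) * (l * v) ≡ r * l * (p * (u * v))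
  shuffle′ = solve-∀
  regroup : ((t + 1) * 2 * q) ^ L * t ^ L ≡ p ^ L * (2 * t) ^ L
  regroup = trans (sym (^-distribʳ-* ((t + 1) * 2 * q) t L)) (trans (cong (_^ L) (identity t q)) (^-distribʳ-* p (2 * t) L))
    where
    identity : ∀ t q → (t + 1) * 2 * q * t ≡ (t + 1) * q * (2 * t)
    identity = solve-∀
  -- Since L ≥ d = 2t a^m, Bernoulli's 1 + L/(2t) exceeds `a ^ m`; the factor `b ^ m`, being at
  -- least 1, is given away.
  absorb : (2 * t) ^ L * a ^ m ≤ r ^ L * b ^ m
  absorb = ≤-trans (*-cancelˡ-≤ (2 * t) {{2t≢0}} (begin
    2 * t * ((2 * t) ^ L * a ^ m)   ≡⟨ rotate (2 * t) ((2 * t) ^ L) (a ^ m) ⟩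
    (2 * t) ^ L * d                 ≤⟨ *-monoʳ-≤ ((2 * t) ^ L) (≤-trans (m≤n+m d m) (m≤n+m L (2 * t))) ⟩
    (2 * t) ^ L * (2 * t + L)       ≤⟨ bernoulli-linear (2 * t) L ⟩
    2 * t * r ^ L                   ∎))
    (m≤m*n (r ^ L) (b ^ m) {{m^n≢0 b m {{m^n≢0 m (m * k)}}}})
    where
    rotate : ∀ a b c → a * (b * c) ≡ b * (a * c)
    rotate = solve-∀
  pull : ∀ x → (x ^ (m * k)) ^ d ≡ ((x ^ m) ^ d) ^ k
  pull x = trans (cong (_^ d) (sym (^-*-assoc x m k))) (^-swap (x ^ m) k d)
  factorial : F * a ^ d ≤ (L ^ k) ^ L * b ^ d
  factorial = subst₂ _≤_
    (trans (^-distribʳ-* (L !) _ k) (cong (F *_) (sym (pull (suc m)))))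
    (trans (^-distribʳ-* (L ^ L) _ k) (cong₂ _*_ (^-swap L L k) (sym (pull m))))
    (^-monoˡ-≤ k (factorial-bound m d))

-- The final 1 + o(1) becomes (t + 1)/t, and e^k becomes (1 + 1/m)^(mk), which increases to it. As t
-- and m are arbitrary and the tolerance 1/s for q/D, D/q and the codegrees may depend on them, the
-- asymptotic bound follows; E = Dn/k by counting incidences.
theorem1p3 : (k : ℕ) → k ≥ 2 →
    (t : ℕ) → t ≥ 1 → (m : ℕ) → m ≥ 1 →
    Σ ℕ λ s → s ≥ 1 × Σ ℕ λ D₀ →
    (n E D q : ℕ) (G : Hypergraph n E) →
    Simple G → Uniform k G → Regular D G → D ≥ D₀ →
    q * s ≤ D * (s + 1) → D * s ≤ q * (s + 1) →
    ((u v : Fin n) → u ≢ v → codegree G u v * s ≤ q) →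
    numProperColorings G q * (t * (m + 1) ^ (m * k)) ^ E
    ≤ ((t + 1) * q * m ^ (m * k)) ^ E
theorem1p3 k@(suc _) k≥2 t@(suc _) t≥1 m@(suc _) m≥1 = s , >-nonZero⁻¹ s {{s≢0}} , 0 , bound
  where
  open ≤-Reasoning
  a = suc m ^ (m * k)
  L = m + 2 * t * a ^ m
  r = suc (2 * t)
  -- `deficient-bound` and D ≤ 2q give deficient · s ≤ K q, so s = C K yields deficient · L^k ≤ q/r.
  -- The bracket is then at most q (r + 1)/r = R/r with r + 1 = 2(t + 1).
  C = L ^ k * r
  K = 2 * k + k * k
  s = C * K
  C≢0 : NonZero C
  C≢0 = m*n≢0 (L ^ k) r {{m^n≢0 L k}}
  s≢0 : NonZero s
  s≢0 = m*n≢0 C K {{C≢0}}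
  bound : ∀ n E D q (G : Hypergraph n E) → Simple G → Uniform k G → Regular D G → D ≥ 0 →
    q * s ≤ D * (s + 1) → D * s ≤ q * (s + 1) →
    ((u v : Fin n) → u ≢ v → codegree G u v * s ≤ q) →
    numProperColorings G q * (t * (m + 1) ^ (m * k)) ^ E ≤ ((t + 1) * q * m ^ (m * k)) ^ E
  bound n E D q G _ uniform regular _ qs≤ Ds≤ codegree≤ =
    subst (λ z → M * (t * z ^ (m * k)) ^ E ≤ v ^ E) (sym (+-comm m 1)) (^-cancelˡ-≤ L (*-cancelʳ-≤ _ _ (x ^ E) {{m^n≢0 x E {{x≢0}}}} (begin
      (M * u ^ E) ^ L * x ^ E         ≡⟨ cong (_* x ^ E) (^-distribʳ-* M (u ^ E) L) ⟩
      M ^ L * (u ^ E) ^ L * x ^ E     ≡⟨ shuffle (M ^ L) ((u ^ E) ^ L) (x ^ E) ⟩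
      M ^ L * x ^ E * (u ^ E) ^ L     ≤⟨ *-monoˡ-≤ ((u ^ E) ^ L) (colourings-bound G k≥2 uniform L {r} {R} room) ⟩
      y ^ E * (u ^ E) ^ L             ≡⟨ cong (y ^ E *_) (^-swap u E L) ⟩
      y ^ E * (u ^ L) ^ E             ≡⟨ ^-distribʳ-* y (u ^ L) E ⟨
      (y * u ^ L) ^ E                 ≤⟨ ^-monoˡ-≤ E (euler-absorb t k m q) ⟩
      (x * v ^ L) ^ E                 ≡⟨ ^-distribʳ-* x (v ^ L) E ⟩
      x ^ E * (v ^ L) ^ E             ≡⟨ trans (*-comm (x ^ E) _) (cong (_* x ^ E) (^-swap v L E)) ⟩
      (v ^ E) ^ L * x ^ E             ∎)))
    where
    M = numProperColorings G q
    R = (t + 1) * 2 * q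
    u = t * a
    v = (t + 1) * q * m ^ (m * k)
    x = (r * L ^ k) ^ L
    y = R ^ L * (L !) ^ k
    x≢0 : NonZero x
    x≢0 = m^n≢0 (r * L ^ k) L {{m*n≢0 r (L ^ k) {{_}} {{m^n≢0 L k}}}}
    shuffle : ∀ a b c → a * b * c ≡ a * c * b
    shuffle = solve-∀
    D≤2q : D ≤ 2 * q
    D≤2q = *-cancelʳ-≤ D (2 * q) s {{s≢0}} (begin
      D * s          ≤⟨ Ds≤ ⟩
      q * (s + 1)    ≤⟨ *-monoʳ-≤ q (+-monoʳ-≤ s (>-nonZero⁻¹ s {{s≢0}})) ⟩
      q * (s + s)    ≡⟨ identity q s ⟩
      2 * q * s      ∎)
      where
      identity : ∀ q s → q * (s + s) ≡ 2 * q * s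
      identity = solve-∀
    deficient≤ : ∀ e X → Proper G X → deficient G k e X * C ≤ q
    deficient≤ e X proper = *-cancelʳ-≤ _ q K (begin
      deficient G k e X * C * K      ≡⟨ *-assoc (deficient G k e X) C K ⟩
      deficient G k e X * s          ≤⟨ deficient-bound G uniform regular qs≤ codegree≤ e X proper ⟩
      k * D + k * k * q              ≤⟨ +-monoˡ-≤ (k * k * q) (*-monoʳ-≤ k D≤2q) ⟩
      k * (2 * q) + k * k * q        ≡⟨ identity k q ⟩
      q * K                          ∎)
      where
      identity : ∀ k q → k * (2 * q) + k * k * q ≡ q * (2 * k + k * k)
      identity = solve-∀
    room : ∀ e X → Proper G X → r * (q + deficient G k e X * L ^ k) ≤ R
    room e X proper = begin
      r * (q + deficient G k e X * L ^ k)        ≡⟨ identity r q (deficient G k e X) (L ^ k) ⟩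
      r * q + deficient G k e X * (L ^ k * r)    ≤⟨ +-monoʳ-≤ (r * q) (deficient≤ e X proper) ⟩
      r * q + q                                  ≡⟨ identity′ t q ⟩
      R                                          ∎
      where
      identity : ∀ r q d l → r * (q + d * l) ≡ r * q + d * (l * r)
      identity = solve-∀
      identity′ : ∀ t q → suc (2 * t) * q + q ≡ (t + 1) * 2 * q
      identity′ = solve-∀
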